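{- Let $G$ be a connected unweighted graph of order $n\ge 2$. Then $$\chi(G)\ \ge\ \frac{1}{K(G)-n+2}.$$
   Context: Graphs are finite, simple, connected and undirected; unweighted means all edge weights are $1$. $\chi(G)$ is the chromatic number. $A$ is the adjacency matrix, $D$ the diagonal degree matrix, and the normalized adjacency matrix $M_G=D^{ -1/2}AD^{ -1/2}$ has eigenvalues $1=\lambda_1>\lambda_2\ge\cdots\ge\lambda_n\ge-1$. Kemeny's constant is $K(G)=\sum_i\pi_i m_{ji}-1$ for the random walk with transition matrix $D^{ -1}A$, where $\pi$ is the stationary distribution and $m_{ji}$ the mean first passage time from $j$ to $i$ (with $m_{jj}$ the mean first return time); this does not depend on $j$, and it is known that $K(G)=\sum_{j=2}^{n}\frac{1}{1-\lambda_j}$. -}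

module Defs where

open import Level using (0ℓ)
open import Data.Nat.Base as ℕ using (ℕ; zero; suc)
open import Data.Integer.Base using (+_)
open import Data.Fin.Base using (Fin)
open import Data.Fin.Properties using (_≟_)
open import Data.Bool.Base using (if_then_else_)
open import Data.Product.Base using (Σ-syntax; ∃-syntax)
open import Data.Rational.Base as ℚ
  using (ℚ; 0ℚ; 1ℚ; _+_; _*_; _-_; _≤_; _<_; ∣_∣; _/_)
open import Algebra.Definitions.RawMonoid ℚ.+-0-rawMonoid using (sum)
import Algebra.Definitions.RawMonoid ℕ.+-0-rawMonoid as ℕΣ
open import Relation.Binary.Core using (Rel)
open import Relation.Binary.Definitions using (Symmetric; Irreflexive; Decidable)
open import Relation.Binary.PropositionalEquality.Core using (_≡_; _≢_)
open import Relation.Binary.Construct.Closure.ReflexiveTransitive using (Star)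
open import Relation.Nullary.Decidable.Core using (⌊_⌋)

ℕtoℚ : ℕ → ℚ
ℕtoℚ n = + n / 1

record Graph (n : ℕ) : Set₁ where
  field
    Adj    : Rel (Fin n) 0ℓ
    adj?   : Decidable Adj
    sym    : Symmetric Adj
    irrefl : Irreflexive _≡_ Adj

module _ {n : ℕ} (G : Graph n) where
  open Graph G

  Connected : Set
  Connected = ∀ u v → Star Adj u v

  Colorable : ℕ → Set
  Colorable k = Σ[ c ∈ (Fin n → Fin k) ] (∀ {u v} → Adj u v → c u ≢ c v)

  record IsChromaticNumber (χ : ℕ) : Set where
    field
      colorable : Colorable χ
      minimal   : ∀ {k} → Colorable k → χ ℕ.≤ k

  adjacency : Fin n → Fin n → ℕ
  adjacency u v = if ⌊ adj? u v ⌋ then 1 else 0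

  degree : Fin n → ℕ
  degree u = ℕΣ.sum (adjacency u)

  -- D⁻¹A.  Division by zero gives 0; it arises only at an isolated vertex,
  -- which a connected graph of order at least 2 does not have.
  transition : Fin n → Fin n → ℚ
  transition u v = adjacency u v ÷₀ degree u
    where
    _÷₀_ : ℕ → ℕ → ℚ
    a ÷₀ zero      = 0ℚ
    a ÷₀ d@(suc _) = + a / d

  record IsStationary (π : Fin n → ℚ) : Set where
    field
      nonNegative : ∀ i → 0ℚ ≤ π i
      total       : sum π ≡ 1ℚ
      invariant   : ∀ i → sum (λ j → π j * transition j i) ≡ π i

  -- firstPassage t j i is the probability that the walk (Xₛ) with X₀ = j has
  -- min { s ≥ 1 : Xₛ = i } = t.  For j = i this is the first return.
  firstPassage : ℕ → Fin n → Fin n → ℚ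
  firstPassage 0             j i = 0ℚ
  firstPassage 1             j i = transition j i
  firstPassage (suc (suc t)) j i =
    sum λ k → if ⌊ k ≟ i ⌋ then 0ℚ else transition j k * firstPassage (suc t) k i

partialSum : (ℕ → ℚ) → ℕ → ℚ
partialSum a zero    = 0ℚ
partialSum a (suc N) = partialSum a N + a N

_SumsTo_ : (ℕ → ℚ) → ℚ → Set
a SumsTo s = ∀ ε → 0ℚ < ε → ∃[ N ] (∀ M → N ℕ.≤ M → ∣ partialSum a M - s ∣ < ε)

module _ {n : ℕ} (G : Graph n) where

  -- The expected first passage time.  The series has a rational sum on a
  -- connected graph of order at least 2, since it solves a nonsingular linear
  -- system with rational coefficients.
  IsMeanFirstPassageTime : Fin n → Fin n → ℚ → Set
  IsMeanFirstPassageTime j i m = (λ t → ℕtoℚ t * firstPassage G t j i) SumsTo m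

  -- The value does not depend on the starting vertex j, so requiring the
  -- defining formula at one j determines K.
  record IsKemenyConstant (K : ℚ) : Set where
    field
      π          : Fin n → ℚ
      stationary : IsStationary G π
      m          : Fin n → Fin n → ℚ
      mean       : ∀ j i → IsMeanFirstPassageTime j i (m j i)
      j          : Fin n
      formula    : K ≡ sum (λ i → π i * m j i) - 1ℚ

{-# OPTIONS --safe #-}
-- Let π = d / vol and let h i u be the mean hitting time of i from u, with h i i = 0.
-- Each h i solves the Poisson equation L (h i) = π − δ i for the Laplacian L of the
-- weights w u v = A u v / vol, and K is the π-average of h i u over i, whatever u is,
-- hence K = Σ_i π i · E(h i) for the Dirichlet form E.  Positivity of E(h i + y) gives
--     E(h i) ≥ 2 (y i − Σ_u π u y u) − E(y)         for every y.
-- Take y = δ i / π i − (1/k) 1_V / π(V), where V is the colour class of i in a proper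
-- k-colouring.  It is supported on an independent set, so E(y) = Σ_u π u (y u)², and
-- summing over i with weights π i yields K ≥ n − 2 + 2/k − k'/k², where k' ≤ k is the
-- number of nonempty classes.  Thus K ≥ n − 2 + 1/k.

module Submission where

open import Defs
open import Data.Nat.Base as ℕ using (ℕ; zero; suc)
import Data.Nat.Properties as ℕₚ
open import Data.Integer.Base as ℤ using (+_)
import Data.Integer.Properties as ℤₚ
open import Data.Fin.Base using (Fin; zero; suc)
open import Data.Fin.Properties using (_≟_; nonZeroIndex)
open import Data.Bool.Base using (if_then_else_)
open import Data.Product.Base using (Σ-syntax; ∃-syntax; _×_; _,_; proj₁; proj₂)
open import Data.Sum.Base using (inj₁; inj₂)
open import Data.Rational.Base hiding (floor)
open import Data.Rational.Properties hiding (_≟_)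
import Data.Rational.Properties as ℚₚ
import Data.Rational.Unnormalised.Base as ℚᵘ
import Data.Rational.Unnormalised.Properties as ℚᵘₚ
open import Algebra.Bundles using (CommutativeRing)
open import Algebra.Properties.Group +-0-group using (x∙y⁻¹≈ε⇒x≈y)
open import Algebra.Properties.Ring +-*-ring using (x[y-z]≈xy-xz)
open import Algebra.Definitions.RawMonoid +-0-rawMonoid using (sum)
import Algebra.Definitions.RawMonoid ℕ.+-0-rawMonoid as ℕΣ
open import Algebra.Definitions.RawSemiring +-*-rawSemiring using (_^_)
open import Algebra.Properties.CommutativeMonoid.Sum +-0-commutativeMonoid
  using (∑-distrib-+; ∑-comm; sum-cong-≗; sum-replicate-zero)
open import Algebra.Properties.Semiring.Sum (CommutativeRing.semiring +-*-commutativeRing)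
  using (*-distribˡ-sum; *-distribʳ-sum)
open import Relation.Binary.Definitions using (tri<; tri≈; tri>)
open import Relation.Binary.PropositionalEquality
open import Relation.Binary.Construct.Closure.ReflexiveTransitive using (Star; _◅_; gmap) renaming (ε to nil)
open import Relation.Nullary using (¬_; Dec; yes; no; contradiction)
open import Relation.Nullary.Decidable.Core using (⌊_⌋; dec⇒maybe)
open import Tactic.RingSolver using (solve-∀)
open import Tactic.RingSolver.Core.AlmostCommutativeRing
  using (AlmostCommutativeRing; fromCommutativeRing)

-- The eigenvalues are in general irrational, so the argument works over ℚ with the Dirichlet form,
-- whose positivity is visible as a sum of squares. Equality in the bound on `E(h i)` holds when `y`
-- is `- h i` up to a constant. The chosen `y` is this optimum for the balanced complete `k`-partite
-- graph, where `K = n - 2 + 1/k`, so the estimate is exact there. With a factor `t` in place of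
-- `1/k` before the class term, the summed bound is `n - 2 + 2t - k't²`, and `t = 1/k` is the best
-- choice when every class is occupied. The mean passage times are given only as sums of series, and
-- the stationary distribution only by its axioms. Decay of the survival probabilities turns the
-- series into first-step equations; averaging these against any stationary distribution gives Kac's
-- formula: stationary mass times mean return time is one. Kac's formula identifies the distribution
-- with `d / vol`, supplies the `δ i` in the Poisson equation and cancels the `-1` in the definition
-- of `K`.

ring : AlmostCommutativeRing _ _
ring = fromCommutativeRing +-*-commutativeRing λ p → dec⇒maybe (0ℚ ℚₚ.≟ p)

-- Order and sign arithmetic in ℚ.

p≤q⇒0≤q-p : ∀ {p q} → p ≤ q → 0ℚ ≤ q - p
p≤q⇒0≤q-p {p} {q} p≤q = subst (_≤ q - p) (+-inverseʳ p) (+-monoˡ-≤ (- p) p≤q)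

0≤q-p⇒p≤q : ∀ {p q} → 0ℚ ≤ q - p → p ≤ q
0≤q-p⇒p≤q {p} {q} 0≤d = subst₂ _≤_ (+-identityˡ p) (cancel q p) (+-monoˡ-≤ p 0≤d)
  where
  cancel : ∀ q p → q - p + p ≡ q
  cancel = solve-∀ ring

p-q≡0⇒p≡q : ∀ {p q} → p - q ≡ 0ℚ → p ≡ q
p-q≡0⇒p≡q = x∙y⁻¹≈ε⇒x≈y _ _

p<q⇒0<q-p : ∀ {p q} → p < q → 0ℚ < q - p
p<q⇒0<q-p {p} {q} p<q = subst (_< q - p) (+-inverseʳ p) (+-monoˡ-< (- p) p<q)

0<q-p⇒p<q : ∀ {p q} → 0ℚ < q - p → p < q
0<q-p⇒p<q {p} {q} 0<d = subst₂ _<_ (+-identityˡ p) (cancel q p) (+-monoˡ-< p 0<d)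
  where
  cancel : ∀ q p → q - p + p ≡ q
  cancel = solve-∀ ring

p≤p+q : ∀ {p q} → 0ℚ ≤ q → p ≤ p + q
p≤p+q {p} {q} 0≤q = subst (_≤ p + q) (+-identityʳ p) (+-monoʳ-≤ p 0≤q)

0≤p*q : ∀ {p q} → 0ℚ ≤ p → 0ℚ ≤ q → 0ℚ ≤ p * q
0≤p*q {p} {q} 0≤p 0≤q =
  nonNegative⁻¹ (p * q) {{nonNeg*nonNeg⇒nonNeg p {{nonNegative 0≤p}} q {{nonNegative 0≤q}}}}

0<p*q : ∀ {p q} → 0ℚ < p → 0ℚ < q → 0ℚ < p * q
0<p*q {p} {q} 0<p 0<q = positive⁻¹ (p * q) {{pos*pos⇒pos p {{positive 0<p}} q {{positive 0<q}}}}

0≤p*p : ∀ p → 0ℚ ≤ p * p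
0≤p*p p with ≤-total 0ℚ p
... | inj₁ 0≤p = 0≤p*q 0≤p 0≤p
... | inj₂ p≤0 =
  nonNegative⁻¹ (p * p) {{nonPos*nonPos⇒nonPos p {{nonPositive p≤0}} p {{nonPositive p≤0}}}}

*-mono-≤-nonNeg : ∀ {p q r s} → 0ℚ ≤ p → 0ℚ ≤ s → p ≤ q → r ≤ s → p * r ≤ q * s
*-mono-≤-nonNeg {p} {q} {r} {s} 0≤p 0≤s p≤q r≤s =
  ≤-trans (*-monoˡ-≤-nonNeg p {{nonNegative 0≤p}} r≤s) (*-monoʳ-≤-nonNeg s {{nonNegative 0≤s}} p≤q)

p*q≡0⇒q≡0 : ∀ {p q} → 0ℚ < p → p * q ≡ 0ℚ → q ≡ 0ℚ
p*q≡0⇒q≡0 {p} {q} 0<p pq≡0 = ≤-antisym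
  (*-cancelˡ-≤-pos p {{positive 0<p}} (≤-reflexive eq))
  (*-cancelˡ-≤-pos p {{positive 0<p}} (≤-reflexive (sym eq)))
  where
  eq : p * q ≡ p * 0ℚ
  eq = trans pq≡0 (sym (*-zeroʳ p))

p*p≡0⇒p≡0 : ∀ p → p * p ≡ 0ℚ → p ≡ 0ℚ
p*p≡0⇒p≡0 p pp≡0 with ℚₚ.<-cmp 0ℚ p
... | tri< 0<p _ _ = p*q≡0⇒q≡0 0<p pp≡0
... | tri≈ _ 0≡p _ = sym 0≡p
... | tri> _ _ p<0 = contradiction (sym pp≡0)
  (<⇒≢ (positive⁻¹ (p * p) {{neg*neg⇒pos p {{negative p<0}} p {{negative p<0}}}}))

≤∧≢⇒< : ∀ {p q} → p ≤ q → p ≢ q → p < q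
≤∧≢⇒< {p} {q} p≤q p≢q with ℚₚ.<-cmp p q
... | tri< p<q _ _ = p<q
... | tri≈ _ p≡q _ = contradiction p≡q p≢q
... | tri> _ _ q<p = contradiction (<-≤-trans q<p p≤q) (<-irrefl refl)

<⇒≱ : ∀ {p q} → p < q → ¬ q ≤ p
<⇒≱ p<q q≤p = <-irrefl refl (<-≤-trans p<q q≤p)

-- Natural numbers and fractions inside ℚ; the archimedean property.

ℕtoℚ-+ : ∀ a b → ℕtoℚ (a ℕ.+ b) ≡ ℕtoℚ a + ℕtoℚ b
ℕtoℚ-+ a b = toℚᵘ-injective (begin
  toℚᵘ (ℕtoℚ (a ℕ.+ b))               ≈⟨ toℚᵘ-fromℚᵘ (ℚᵘ.mkℚᵘ (+ (a ℕ.+ b)) 0) ⟩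
  ℚᵘ.mkℚᵘ (+ (a ℕ.+ b)) 0             ≈⟨ ℚᵘ.*≡* (cong (ℤ._* (+ 1)) (sym (cong₂ ℤ._+_ (ℤₚ.*-identityʳ (+ a)) (ℤₚ.*-identityʳ (+ b))))) ⟩
  ℚᵘ.mkℚᵘ (+ a) 0 ℚᵘ.+ ℚᵘ.mkℚᵘ (+ b) 0 ≈⟨ ℚᵘₚ.+-cong (toℚᵘ-fromℚᵘ (ℚᵘ.mkℚᵘ (+ a) 0)) (toℚᵘ-fromℚᵘ (ℚᵘ.mkℚᵘ (+ b) 0)) ⟨
  toℚᵘ (ℕtoℚ a) ℚᵘ.+ toℚᵘ (ℕtoℚ b)    ≈⟨ toℚᵘ-homo-+ (ℕtoℚ a) (ℕtoℚ b) ⟨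
  toℚᵘ (ℕtoℚ a + ℕtoℚ b)              ∎)
  where open ℚᵘₚ.≃-Reasoning

[a/d]*d≡a : ∀ a d .{{_ : ℕ.NonZero d}} → (+ a / d) * ℕtoℚ d ≡ ℕtoℚ a
[a/d]*d≡a a (suc d) = toℚᵘ-injective (begin
  toℚᵘ ((+ a / suc d) * ℕtoℚ (suc d))   ≈⟨ toℚᵘ-homo-* (+ a / suc d) (ℕtoℚ (suc d)) ⟩
  toℚᵘ (+ a / suc d) ℚᵘ.* toℚᵘ (ℕtoℚ (suc d))
    ≈⟨ ℚᵘₚ.*-cong (toℚᵘ-fromℚᵘ (ℚᵘ.mkℚᵘ (+ a) d)) (toℚᵘ-fromℚᵘ (ℚᵘ.mkℚᵘ (+ suc d) 0)) ⟩
  ℚᵘ.mkℚᵘ (+ a) d ℚᵘ.* ℚᵘ.mkℚᵘ (+ suc d) 0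
    ≈⟨ ℚᵘ.*≡* (trans (ℤₚ.*-identityʳ _) (cong (λ e → + a ℤ.* + e) (sym (ℕₚ.*-identityʳ (suc d))))) ⟩
  ℚᵘ.mkℚᵘ (+ a) 0                       ≈⟨ toℚᵘ-fromℚᵘ (ℚᵘ.mkℚᵘ (+ a) 0) ⟨
  toℚᵘ (ℕtoℚ a)                         ∎)
  where open ℚᵘₚ.≃-Reasoning

0≤a/d : ∀ a d .{{_ : ℕ.NonZero d}} → 0ℚ ≤ + a / d
0≤a/d a d = nonNegative⁻¹ (+ a / d) {{normalize-nonNeg a d}}

0<a/d : ∀ a d .{{_ : ℕ.NonZero a}} .{{_ : ℕ.NonZero d}} → 0ℚ < + a / d
0<a/d a d = positive⁻¹ (+ a / d) {{normalize-pos a d}}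

0≤ℕtoℚ : ∀ a → 0ℚ ≤ ℕtoℚ a
0≤ℕtoℚ a = 0≤a/d a 1

-- Multiplying by the denominator leaves the numerator, a positive integer.
1≤↧p*p : ∀ p → Positive p → 1ℚ ≤ ℕtoℚ (↧ₙ p) * p
1≤↧p*p p@(mkℚ (+ suc a) d-1 _) _ = begin
  1ℚ                                         ≤⟨ p≤p+q (0≤ℕtoℚ a) ⟩
  1ℚ + ℕtoℚ a                                ≡⟨ ℕtoℚ-+ 1 a ⟨
  ℕtoℚ (suc a)                               ≡⟨ [a/d]*d≡a (suc a) (suc d-1) ⟨
  (+ suc a / suc d-1) * ℕtoℚ (suc d-1)       ≡⟨ cong (_* ℕtoℚ (suc d-1)) (↥p/↧p≡p p) ⟩
  p * ℕtoℚ (suc d-1)                         ≡⟨ *-comm p (ℕtoℚ (suc d-1)) ⟩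
  ℕtoℚ (suc d-1) * p                         ∎
  where open ≤-Reasoning

archimedean : ∀ {p} → 0ℚ < p → ∃[ a ] 1ℚ < ℕtoℚ a * p
-- The denominator alone gives only a weak inequality; doubling it makes the inequality strict.
archimedean {p} 0<p = d ℕ.+ d , (begin-strict
  1ℚ                            <⟨ +-monoʳ-< 1ℚ (0<a/d 1 1) ⟩
  1ℚ + 1ℚ                       ≤⟨ +-mono-≤ 1≤dp 1≤dp ⟩
  ℕtoℚ d * p + ℕtoℚ d * p       ≡⟨ *-distribʳ-+ p (ℕtoℚ d) (ℕtoℚ d) ⟨
  (ℕtoℚ d + ℕtoℚ d) * p         ≡⟨ cong (_* p) (ℕtoℚ-+ d d) ⟨
  ℕtoℚ (d ℕ.+ d) * p            ∎)
  where
  open ≤-Reasoning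
  d = ↧ₙ p
  1≤dp = 1≤↧p*p p (positive 0<p)

-- Finite sums and the Kronecker delta.

sum-mono : ∀ {n} {f g : Fin n → ℚ} → (∀ i → f i ≤ g i) → sum f ≤ sum g
sum-mono {zero}  f≤g = ≤-refl
sum-mono {suc n} f≤g = +-mono-≤ (f≤g zero) (sum-mono λ i → f≤g (suc i))

sum-nonNeg : ∀ {n} {f : Fin n → ℚ} → (∀ i → 0ℚ ≤ f i) → 0ℚ ≤ sum f
sum-nonNeg {n} {f} 0≤f = subst (_≤ sum f) (sum-replicate-zero n) (sum-mono 0≤f)

≤-sum : ∀ {n} {f : Fin n → ℚ} → (∀ i → 0ℚ ≤ f i) → ∀ i → f i ≤ sum f
≤-sum {suc n} {f} 0≤f zero    = subst (_≤ sum f) (+-identityʳ (f zero))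
  (+-monoʳ-≤ (f zero) (sum-nonNeg λ i → 0≤f (suc i)))
≤-sum {suc n} {f} 0≤f (suc i) = subst (_≤ sum f) (+-identityˡ (f (suc i)))
  (+-mono-≤ (0≤f zero) (≤-sum (λ k → 0≤f (suc k)) i))

sum-neg : ∀ {n} (f : Fin n → ℚ) → sum (λ i → - f i) ≡ - sum f
sum-neg {zero}  f = refl
sum-neg {suc n} f = trans (cong (_+_ (- f zero)) (sum-neg (λ i → f (suc i))))
  (sym (neg-distrib-+ (f zero) _))

sum-- : ∀ {n} (f g : Fin n → ℚ) → sum (λ i → f i - g i) ≡ sum f - sum g
sum-- f g = trans (∑-distrib-+ f (λ i → - g i)) (cong (_+_ (sum f)) (sum-neg g))

sum-linear : ∀ {n} p q (f g : Fin n → ℚ) → sum (λ i → p * f i + q * g i) ≡ p * sum f + q * sum g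
sum-linear p q f g = trans (∑-distrib-+ (λ i → p * f i) (λ i → q * g i))
  (cong₂ _+_ (sym (*-distribˡ-sum p f)) (sym (*-distribˡ-sum q g)))

sum-1 : ∀ n → sum {n} (λ _ → 1ℚ) ≡ ℕtoℚ n
sum-1 zero    = refl
sum-1 (suc n) = trans (cong (_+_ 1ℚ) (sum-1 n)) (sym (ℕtoℚ-+ 1 n))

ℕtoℚ-sum : ∀ {n} (f : Fin n → ℕ) → ℕtoℚ (ℕΣ.sum f) ≡ sum (λ i → ℕtoℚ (f i))
ℕtoℚ-sum {zero}  f = refl
ℕtoℚ-sum {suc n} f = trans (ℕtoℚ-+ (f zero) _) (cong (_+_ (ℕtoℚ (f zero))) (ℕtoℚ-sum λ i → f (suc i)))

δ : ∀ {n} → Fin n → Fin n → ℚ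
δ i j = if ⌊ i ≟ j ⌋ then 1ℚ else 0ℚ

δ-refl : ∀ {n} (i : Fin n) → δ i i ≡ 1ℚ
δ-refl i with i ≟ i
... | yes _  = refl
... | no i≢i = contradiction refl i≢i

δ-≢ : ∀ {n} {i j : Fin n} → i ≢ j → δ i j ≡ 0ℚ
δ-≢ {i = i} {j} i≢j with i ≟ j
... | yes i≡j = contradiction i≡j i≢j
... | no _    = refl

δ-suc : ∀ {n} (i j : Fin n) → δ (suc i) (suc j) ≡ δ i j
δ-suc i j with i ≟ j
... | yes _ = refl
... | no _  = refl

δ-sym : ∀ {n} (i j : Fin n) → δ i j ≡ δ j i
δ-sym i j with i ≟ j
... | yes refl = sym (δ-refl i)
... | no i≢j   = sym (δ-≢ λ j≡i → i≢j (sym j≡i))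

sum-δ : ∀ {n} (i : Fin n) (f : Fin n → ℚ) → sum (λ j → δ j i * f j) ≡ f i
sum-δ {suc n} zero f = begin
  1ℚ * f zero + sum (λ j → 0ℚ * f (suc j))
    ≡⟨ cong₂ _+_ (*-identityˡ (f zero)) (trans (sum-cong-≗ λ j → *-zeroˡ (f (suc j))) (sum-replicate-zero n)) ⟩
  f zero + 0ℚ ≡⟨ +-identityʳ (f zero) ⟩
  f zero      ∎
  where open ≡-Reasoning
sum-δ {suc n} (suc i) f = begin
  0ℚ * f zero + sum (λ j → δ (suc j) (suc i) * f (suc j))
    ≡⟨ cong₂ _+_ (*-zeroˡ (f zero)) (sum-cong-≗ λ j → cong (_* f (suc j)) (δ-suc j i)) ⟩
  0ℚ + sum (λ j → δ j i * f (suc j)) ≡⟨ +-identityˡ _ ⟩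
  sum (λ j → δ j i * f (suc j))      ≡⟨ sum-δ i (λ j → f (suc j)) ⟩
  f (suc i)                          ∎
  where open ≡-Reasoning

-- Rational sequences with limit zero.

-- `a SumsTo s` unfolds to `Null` of `partialSum a M - s`, so a proof of the one serves as a proof
-- of the other.
Null : (ℕ → ℚ) → Set
Null a = ∀ ε → 0ℚ < ε → ∃[ N ] (∀ M → N ℕ.≤ M → ∣ a M ∣ < ε)

null-cong : ∀ {a b} → (∀ M → a M ≡ b M) → Null a → Null b
null-cong a≡b null-a ε 0<ε with null-a ε 0<ε
... | N , small = N , λ M N≤M → subst (λ p → ∣ p ∣ < ε) (a≡b M) (small M N≤M)

null-shift : ∀ {a} → Null a → Null (λ M → a (suc M))
null-shift null-a ε 0<ε with null-a ε 0<ε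
... | N , small = N , λ M N≤M → small (suc M) (ℕₚ.m≤n⇒m≤1+n N≤M)

null-+ : ∀ {a b} → Null a → Null b → Null (λ M → a M + b M)
null-+ {a} {b} null-a null-b ε 0<ε with null-a (½ * ε) 0<½ε | null-b (½ * ε) 0<½ε
  where 0<½ε = 0<p*q (0<a/d 1 2) 0<ε
... | N₁ , small₁ | N₂ , small₂ = N₁ ℕ.⊔ N₂ , λ M N≤M → begin-strict
  ∣ a M + b M ∣       ≤⟨ ∣p+q∣≤∣p∣+∣q∣ (a M) (b M) ⟩
  ∣ a M ∣ + ∣ b M ∣   <⟨ +-mono-< (small₁ M (ℕₚ.m⊔n≤o⇒m≤o N₁ N₂ N≤M)) (small₂ M (ℕₚ.m⊔n≤o⇒n≤o N₁ N₂ N≤M)) ⟩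
  ½ * ε + ½ * ε       ≡⟨ *-distribʳ-+ ε ½ ½ ⟨
  1ℚ * ε              ≡⟨ *-identityˡ ε ⟩
  ε                   ∎
  where open ≤-Reasoning

null-*ˡ : ∀ p {a} → Null a → Null (λ M → p * a M)
null-*ˡ p {a} null-a ε 0<ε = let N , small = null-a (1/ d * ε) 0<ε/d in N , λ M N≤M → begin-strict
  ∣ p * a M ∣       ≡⟨ ∣p*q∣≡∣p∣*∣q∣ p (a M) ⟩
  ∣ p ∣ * ∣ a M ∣   ≤⟨ *-monoʳ-≤-nonNeg ∣ a M ∣ {{∣-∣-nonNeg (a M)}} ∣p∣≤d ⟩
  d * ∣ a M ∣       <⟨ *-monoʳ-<-pos d (small M N≤M) ⟩
  d * (1/ d * ε)    ≡⟨ *-assoc d (1/ d) ε ⟨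
  d * 1/ d * ε      ≡⟨ cong (_* ε) (*-inverseʳ d) ⟩
  1ℚ * ε            ≡⟨ *-identityˡ ε ⟩
  ε                 ∎
  where
  open ≤-Reasoning
  -- The summand 1 keeps the divisor positive even when `p` is zero.
  d = 1ℚ + ∣ p ∣
  instance
    d>0 : Positive d
    d>0 = pos+nonNeg⇒pos 1ℚ ∣ p ∣ {{∣-∣-nonNeg p}}
    d≢0 : NonZero d
    d≢0 = pos⇒nonZero d
  0<ε/d : 0ℚ < 1/ d * ε
  0<ε/d = 0<p*q (positive⁻¹ (1/ d) {{1/pos⇒pos d}}) 0<ε
  ∣p∣≤d : ∣ p ∣ ≤ d
  ∣p∣≤d = subst (∣ p ∣ ≤_) (+-comm ∣ p ∣ 1ℚ) (p≤p+q (0≤a/d 1 1))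

null-0 : Null (λ _ → 0ℚ)
null-0 ε 0<ε = 0 , λ _ _ → 0<ε

null-neg : ∀ {a} → Null a → Null (λ M → - a M)
null-neg {a} null-a ε 0<ε with null-a ε 0<ε
... | N , small = N , λ M N≤M → subst (_< ε) (sym (∣-p∣≡∣p∣ (a M))) (small M N≤M)

null-sum : ∀ {n} {a : Fin n → ℕ → ℚ} → (∀ k → Null (a k)) → Null (λ M → sum (λ k → a k M))
null-sum {zero}  null-a = null-0
null-sum {suc n} null-a = null-+ (null-a zero) (null-sum λ k → null-a (suc k))

-- The tolerance `∣ p ∣` itself would be violated. This is how a limit of approximate equations
-- becomes an exact equation in ℚ.
null-const : ∀ {p} → Null (λ _ → p) → p ≡ 0ℚ
null-const {p} null-p with ∣ p ∣ ℚₚ.≟ 0ℚ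
... | yes ∣p∣≡0 = ∣p∣≡0⇒p≡0 p ∣p∣≡0
... | no ∣p∣≢0 with null-p ∣ p ∣ (≤∧≢⇒< (0≤∣p∣ p) (λ 0≡∣p∣ → ∣p∣≢0 (sym 0≡∣p∣)))
...   | N , small = contradiction (small N ℕₚ.≤-refl) (<-irrefl refl)

-- Geometric decay.

0≤p^a : ∀ {p} → 0ℚ ≤ p → ∀ a → 0ℚ ≤ p ^ a
0≤p^a 0≤p zero    = 0≤a/d 1 1
0≤p^a 0≤p (suc a) = 0≤p*q 0≤p (0≤p^a 0≤p a)

-- Bernoulli's inequality for 1/p, with the denominator cleared.
bernoulli : ∀ {p} → 0ℚ ≤ p → ∀ a → (1ℚ + ℕtoℚ a * (1ℚ - p)) * p ^ a ≤ 1ℚ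
bernoulli {p} 0≤p zero = ≤-reflexive (base p)
  where
  base : ∀ p → (1ℚ + 0ℚ * (1ℚ - p)) * 1ℚ ≡ 1ℚ
  base = solve-∀ ring
bernoulli {p} 0≤p (suc a) = begin
  (1ℚ + ℕtoℚ (suc a) * (1ℚ - p)) * (p * p ^ a)
    ≡⟨ cong (λ b → (1ℚ + b * (1ℚ - p)) * (p * p ^ a)) (ℕtoℚ-+ 1 a) ⟩
  (1ℚ + (1ℚ + ℕtoℚ a) * (1ℚ - p)) * (p * p ^ a)
    -- The added nonnegative term is exactly what is missing from the expression for `a`.
    ≤⟨ p≤p+q (0≤p*q (0≤p*q (≤-trans (0≤a/d 1 1) (p≤p+q (0≤ℕtoℚ a))) (0≤p*p (1ℚ - p))) (0≤p^a 0≤p a)) ⟩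
  (1ℚ + (1ℚ + ℕtoℚ a) * (1ℚ - p)) * (p * p ^ a) + (1ℚ + ℕtoℚ a) * ((1ℚ - p) * (1ℚ - p)) * p ^ a
    ≡⟨ step p (ℕtoℚ a) (p ^ a) ⟩
  (1ℚ + ℕtoℚ a * (1ℚ - p)) * p ^ a
    ≤⟨ bernoulli 0≤p a ⟩
  1ℚ ∎
  where
  open ≤-Reasoning
  step : ∀ p x y → (1ℚ + (1ℚ + x) * (1ℚ - p)) * (p * y) + (1ℚ + x) * ((1ℚ - p) * (1ℚ - p)) * y
         ≡ (1ℚ + x * (1ℚ - p)) * y
  step = solve-∀ ring

-- If `p ^ a` were at least `ε`, Bernoulli's inequality would keep `a (1 - p) ε` at most 1.
power-< : ∀ {p} → 0ℚ ≤ p → p < 1ℚ → ∀ ε a → 1ℚ < ℕtoℚ a * ((1ℚ - p) * ε) → p ^ a < ε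
power-< {p} 0≤p p<1 ε a 1<aηε = ≰⇒> λ ε≤p^a → <⇒≱ 1<aηε (begin
  ℕtoℚ a * ((1ℚ - p) * ε)         ≡⟨ *-assoc (ℕtoℚ a) (1ℚ - p) ε ⟨
  x * ε                           ≤⟨ *-mono-≤-nonNeg 0≤x (0≤p^a 0≤p a) x≤1+x ε≤p^a ⟩
  (1ℚ + x) * p ^ a                ≤⟨ bernoulli 0≤p a ⟩
  1ℚ                              ∎)
  where
  open ≤-Reasoning
  x = ℕtoℚ a * (1ℚ - p)
  0≤x : 0ℚ ≤ x
  0≤x = 0≤p*q (0≤ℕtoℚ a) (p≤q⇒0≤q-p (<⇒≤ p<1))
  x≤1+x : x ≤ 1ℚ + x
  x≤1+x = subst (x ≤_) (+-comm x 1ℚ) (p≤p+q (0≤a/d 1 1))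

power-small : ∀ {p} → 0ℚ ≤ p → p < 1ℚ → ∀ ε → 0ℚ < ε → ∃[ a ] p ^ a < ε
power-small {p} 0≤p p<1 ε 0<ε = a , power-< 0≤p p<1 ε a 1<aηε
  where
  big = archimedean (0<p*q (p<q⇒0<q-p p<1) 0<ε)
  a = proj₁ big
  1<aηε = proj₂ big

-- Uniform choices over a finite vertex set.

uniform-stage : ∀ {n} (P : Fin n → ℕ → Set) → (∀ {i s t} → s ℕ.≤ t → P i s → P i t) →
                (∀ i → ∃[ t ] P i t) → ∃[ t ] (∀ i → P i t)
uniform-stage {zero}  P mono stage = 0 , λ ()
uniform-stage {suc n} P mono stage with stage zero | uniform-stage (λ i → P (suc i)) mono (λ i → stage (suc i))
... | s , Ps | t , Pt = s ℕ.⊔ t , λ where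
  zero    → mono (ℕₚ.m≤m⊔n s t) Ps
  (suc i) → mono (ℕₚ.m≤n⊔m s t) (Pt i)

-- A maximum of finitely many numbers stays strictly below 1. Including 0 in it makes the result
-- usable as a geometric ratio.
uniform-bound : ∀ {n} (a : Fin n → ℚ) → (∀ i → a i < 1ℚ) →
                ∃[ p ] (0ℚ ≤ p × p < 1ℚ × (∀ i → a i ≤ p))
uniform-bound {zero}  a a<1 = 0ℚ , ≤-refl , 0<a/d 1 1 , λ ()
uniform-bound {suc n} a a<1 with uniform-bound (λ i → a (suc i)) (λ i → a<1 (suc i))
... | p , 0≤p , p<1 , a≤p with ≤-total (a zero) p
...   | inj₁ a₀≤p = p , 0≤p , p<1 , λ { zero → a₀≤p ; (suc i) → a≤p i }
...   | inj₂ p≤a₀ = a zero , ≤-trans 0≤p p≤a₀ , a<1 zero ,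
                    λ { zero → ≤-refl ; (suc i) → ≤-trans (a≤p i) p≤a₀ }

-- From the first-passage series to the first-step equations, for a fixed target `i`.

module FirstPassage {n : ℕ} (G : Graph n)
  (0≤P : ∀ u v → 0ℚ ≤ transition G u v)
  (P-row : ∀ u → sum (transition G u) ≡ 1ℚ)
  (edge⇒0<P : ∀ {u v} → Graph.Adj G u v → 0ℚ < transition G u v)
  (neighbour : ∀ u → ∃[ v ] Graph.Adj G u v)
  (i : Fin n) where

  open Graph G using (Adj)

  P : Fin n → Fin n → ℚ
  P = transition G

  -- The chain killed on arrival at i.
  Q : Fin n → Fin n → ℚ
  Q j k = if ⌊ k ≟ i ⌋ then 0ℚ else P j k

  0≤Q : ∀ j k → 0ℚ ≤ Q j k
  0≤Q j k with k ≟ i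
  ... | yes _ = ≤-refl
  ... | no _  = 0≤P j k

  δP+Q≡P : ∀ j k → δ k i * P j k + Q j k ≡ P j k
  δP+Q≡P j k with k ≟ i
  ... | yes _ = trans (+-identityʳ _) (*-identityˡ (P j k))
  ... | no _  = trans (cong (_+ P j k) (*-zeroˡ (P j k))) (+-identityˡ (P j k))

  P+ΣQ≡1 : ∀ j → P j i + sum (Q j) ≡ 1ℚ
  P+ΣQ≡1 j = begin
    P j i + sum (Q j)                          ≡⟨ cong (_+ sum (Q j)) (sum-δ i (P j)) ⟨
    sum (λ k → δ k i * P j k) + sum (Q j)      ≡⟨ ∑-distrib-+ (λ k → δ k i * P j k) (Q j) ⟨
    sum (λ k → δ k i * P j k + Q j k)          ≡⟨ sum-cong-≗ (δP+Q≡P j) ⟩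
    sum (P j)                                  ≡⟨ P-row j ⟩
    1ℚ                                         ∎
    where open ≡-Reasoning

  ΣQ≤1 : ∀ j → sum (Q j) ≤ 1ℚ
  ΣQ≤1 j = subst (sum (Q j) ≤_) (trans (+-comm (sum (Q j)) (P j i)) (P+ΣQ≡1 j)) (p≤p+q (0≤P j i))

  Q·-mono : ∀ j {f g : Fin n → ℚ} → (∀ k → f k ≤ g k) → sum (λ k → Q j k * f k) ≤ sum (λ k → Q j k * g k)
  Q·-mono j f≤g = sum-mono λ k → *-monoˡ-≤-nonNeg (Q j k) {{nonNegative (0≤Q j k)}} (f≤g k)

  Q·-- : ∀ j (f g : Fin n → ℚ) →
         sum (λ k → Q j k * (f k - g k)) ≡ sum (λ k → Q j k * f k) - sum (λ k → Q j k * g k)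
  Q·-- j f g = trans (sum-cong-≗ λ k → x[y-z]≈xy-xz (Q j k) (f k) (g k))
                     (sum-- (λ k → Q j k * f k) (λ k → Q j k * g k))

  -- The probability that i is not visited at any of the times 1, …, t.
  survival : ℕ → Fin n → ℚ
  survival zero    j = 1ℚ
  survival (suc t) j = sum λ k → Q j k * survival t k

  0≤survival : ∀ t j → 0ℚ ≤ survival t j
  0≤survival zero    j = 0≤a/d 1 1
  0≤survival (suc t) j = sum-nonNeg λ k → 0≤p*q (0≤Q j k) (0≤survival t k)

  survival-1 : ∀ j → survival 1 j ≡ sum (Q j)
  survival-1 j = sum-cong-≗ λ k → *-identityʳ (Q j k)

  survival-suc-≤ : ∀ t j → survival (suc t) j ≤ survival t j
  survival-suc-≤ zero    j = subst (_≤ 1ℚ) (sym (survival-1 j)) (ΣQ≤1 j)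
  survival-suc-≤ (suc t) j = Q·-mono j (survival-suc-≤ t)

  survival-antitone : ∀ {s t} → s ℕ.≤ t → ∀ j → survival t j ≤ survival s j
  survival-antitone {s} s≤t j = go (ℕₚ.≤⇒≤′ s≤t)
    where
    go : ∀ {t} → s ℕ.≤′ t → survival t j ≤ survival s j
    go (ℕ.≤′-reflexive refl)    = ≤-refl
    go (ℕ.≤′-step {t} s≤′t) = ≤-trans (survival-suc-≤ t j) (go s≤′t)

  survival-≤1 : ∀ t j → survival t j ≤ 1ℚ
  survival-≤1 t = survival-antitone {0} {t} ℕ.z≤n

  -- Markov property: wherever the walk stands after `t` steps without a visit, it avoids `i` for
  -- `s` more steps with probability at most `p`.
  survival-+-≤ : ∀ {p} s → (∀ j → survival s j ≤ p) → ∀ t j → survival (t ℕ.+ s) j ≤ p * survival t j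
  survival-+-≤ {p} s bound zero    j = subst (survival s j ≤_) (sym (*-identityʳ p)) (bound j)
  survival-+-≤ {p} s bound (suc t) j = begin
    sum (λ k → Q j k * survival (t ℕ.+ s) k)    ≤⟨ Q·-mono j (survival-+-≤ s bound t) ⟩
    sum (λ k → Q j k * (p * survival t k))      ≡⟨ sum-cong-≗ (λ k → swap (Q j k) p (survival t k)) ⟩
    sum (λ k → p * (Q j k * survival t k))      ≡⟨ *-distribˡ-sum p (λ k → Q j k * survival t k) ⟨
    p * sum (λ k → Q j k * survival t k)        ∎
    where
    open ≤-Reasoning
    swap : ∀ q p s → q * (p * s) ≡ p * (q * s)
    swap = solve-∀ ring

  hit-now : ∀ {j} → Adj j i → survival 1 j < 1ℚ
  hit-now {j} j∼i = begin-strict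
    survival 1 j                ≡⟨ survival-1 j ⟩
    sum (Q j)                   ≡⟨ +-identityˡ (sum (Q j)) ⟨
    0ℚ + sum (Q j)              <⟨ +-monoˡ-< (sum (Q j)) (edge⇒0<P j∼i) ⟩
    P j i + sum (Q j)           ≡⟨ P+ΣQ≡1 j ⟩
    1ℚ                          ∎
    where open ≤-Reasoning

  0<Q : ∀ {j k} → k ≢ i → Adj j k → 0ℚ < Q j k
  0<Q {j} {k} k≢i j∼k with k ≟ i
  ... | yes k≡i = contradiction k≡i k≢i
  ... | no _    = edge⇒0<P j∼k

  -- The deficit `1ℚ - survival t k` is inherited by `j` with weight `Q j k`, which is positive
  -- because the step to `k` does not end the walk.
  hit-later : ∀ {j k} t → k ≢ i → Adj j k → survival t k < 1ℚ → survival (suc t) j < 1ℚ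
  hit-later {j} {k} t k≢i j∼k Gk<1 = 0<q-p⇒p<q (begin-strict
    0ℚ                                          <⟨ 0<p*q (0<Q k≢i j∼k) (p<q⇒0<q-p Gk<1) ⟩
    Q j k * (1ℚ - survival t k)                 ≤⟨ ≤-sum (λ l → 0≤p*q (0≤Q j l) (p≤q⇒0≤q-p (survival-≤1 t l))) k ⟩
    sum (λ l → Q j l * (1ℚ - survival t l))     ≡⟨ Q·-- j (λ _ → 1ℚ) (survival t) ⟩
    survival 1 j - survival (suc t) j           ≤⟨ +-monoˡ-≤ (- survival (suc t) j) (survival-≤1 1 j) ⟩
    1ℚ - survival (suc t) j                     ∎)
    where open ≤-Reasoning

  -- A path is followed up to its first arrival at `i`. Visits count from time 1 on, so the empty
  -- path at `i` proves nothing, and a detour to a neighbour and back replaces it.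
  hit : ∀ {j} → Star Adj j i → ∃[ t ] survival t j < 1ℚ
  hit-after-step : ∀ {j k} → Adj j k → Star Adj k i → ∃[ t ] survival t j < 1ℚ
  hit-from-target : ∃[ t ] survival t i < 1ℚ

  hit nil             = hit-from-target
  hit (j∼k ◅ k⇝i)     = hit-after-step j∼k k⇝i

  hit-after-step {j} {k} j∼k k⇝i with k ≟ i
  ... | yes refl = 1 , hit-now j∼k
  hit-after-step j∼k nil            | no k≢i = contradiction refl k≢i
  hit-after-step j∼k (k∼l ◅ l⇝i)    | no k≢i with hit-after-step k∼l l⇝i
  ...   | t , Gk<1 = suc t , hit-later t k≢i j∼k Gk<1

  hit-from-target with neighbour i
  ... | k , i∼k = hit-after-step i∼k (Graph.sym G i∼k ◅ nil)

  module _ (reach : ∀ j → Star Adj j i) where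

    -- Finiteness gives one block length `s` and one ratio `p` for all starting vertices; each
    -- further block of `s` steps then costs a factor `p`.
    survival-geometric : ∃[ s ] ∃[ p ] (0ℚ ≤ p × p < 1ℚ × (∀ a j → survival (a ℕ.* s) j ≤ p ^ a))
    survival-geometric =
      let s , Gs<1 = uniform-stage (λ j t → survival t j < 1ℚ)
                       (λ {j} s≤t Gs<1 → ≤-<-trans (survival-antitone s≤t j) Gs<1) (λ j → hit (reach j))
          p , 0≤p , p<1 , Gs≤p = uniform-bound (survival s) Gs<1
      in  s , p , 0≤p , p<1 , bound s p 0≤p Gs≤p
      where
      bound : ∀ s p → 0ℚ ≤ p → (∀ j → survival s j ≤ p) → ∀ a j → survival (a ℕ.* s) j ≤ p ^ a
      bound s p 0≤p Gs≤p zero    j = ≤-refl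
      bound s p 0≤p Gs≤p (suc a) j = begin
        survival (s ℕ.+ a ℕ.* s) j   ≤⟨ survival-+-≤ (a ℕ.* s) (bound s p 0≤p Gs≤p a) s j ⟩
        p ^ a * survival s j         ≤⟨ *-monoˡ-≤-nonNeg (p ^ a) {{nonNegative (0≤p^a 0≤p a)}} (Gs≤p j) ⟩
        p ^ a * p                    ≡⟨ *-comm (p ^ a) p ⟩
        p * p ^ a                    ∎
        where open ≤-Reasoning

    null-survival : ∀ j → Null (λ t → survival t j)
    null-survival j ε 0<ε =
      let s , p , 0≤p , p<1 , bound = survival-geometric
          a , p^a<ε = power-small 0≤p p<1 ε 0<ε
      in  a ℕ.* s , λ t as≤t → begin-strict
        ∣ survival t j ∣        ≡⟨ 0≤p⇒∣p∣≡p (0≤survival t j) ⟩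
        survival t j            ≤⟨ survival-antitone as≤t j ⟩
        survival (a ℕ.* s) j    ≤⟨ bound a j ⟩
        p ^ a                   <⟨ p^a<ε ⟩
        ε                       ∎
      where open ≤-Reasoning

    firstPassage-suc-suc : ∀ t j → firstPassage G (suc (suc t)) j i ≡ sum (λ k → Q j k * firstPassage G (suc t) k i)
    firstPassage-suc-suc t j = sum-cong-≗ term
      where
      term : ∀ k → (if ⌊ k ≟ i ⌋ then 0ℚ else P j k * firstPassage G (suc t) k i) ≡ Q j k * firstPassage G (suc t) k i
      term k with k ≟ i
      ... | yes _ = sym (*-zeroˡ (firstPassage G (suc t) k i))
      ... | no _  = refl

    -- A first visit at time `suc t` means none up to `t` but one by `suc t`. Formally, both sides
    -- obey the same recursion under `Q`.
    firstPassage-survival : ∀ t j → firstPassage G (suc t) j i ≡ survival t j - survival (suc t) j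
    firstPassage-survival zero    j = begin
      P j i                               ≡⟨ p≡p+q-q (P j i) (sum (Q j)) ⟩
      P j i + sum (Q j) - sum (Q j)       ≡⟨ cong₂ _-_ (P+ΣQ≡1 j) (sym (survival-1 j)) ⟩
      1ℚ - survival 1 j                   ∎
      where
      open ≡-Reasoning
      p≡p+q-q : ∀ p q → p ≡ p + q - q
      p≡p+q-q = solve-∀ ring
    firstPassage-survival (suc t) j = begin
      firstPassage G (suc (suc t)) j i                        ≡⟨ firstPassage-suc-suc t j ⟩
      sum (λ k → Q j k * firstPassage G (suc t) k i)          ≡⟨ sum-cong-≗ (λ k → cong (Q j k *_) (firstPassage-survival t k)) ⟩
      sum (λ k → Q j k * (survival t k - survival (suc t) k)) ≡⟨ Q·-- j (survival t) (survival (suc t)) ⟩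
      survival (suc t) j - survival (suc (suc t)) j           ∎
      where open ≡-Reasoning

    S : ℕ → Fin n → ℚ
    S M j = partialSum (λ t → ℕtoℚ t * firstPassage G t j i) M

    -- First-step analysis with a cut-off. `S (suc M)` is the expected passage time restricted to
    -- passage by time `M`; the first step adds 1 on the event of passage by time `suc M`, whose
    -- probability is `1ℚ - survival (suc M) j`.
    S-step : ∀ M j → S (suc (suc M)) j ≡ 1ℚ + sum (λ k → Q j k * S (suc M) k) - survival (suc M) j
    S-step zero j = begin
      0ℚ + 0ℚ * 0ℚ + 1ℚ * P j i                                      ≡⟨ *-identityˡ-+ (P j i) ⟩
      P j i                                                          ≡⟨ firstPassage-survival 0 j ⟩
      1ℚ - survival 1 j                                              ≡⟨ cong (λ p → p - survival 1 j) (+-identityʳ 1ℚ) ⟨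
      1ℚ + 0ℚ - survival 1 j                                         ≡⟨ cong (λ p → 1ℚ + p - survival 1 j) Q·0≡0 ⟨
      1ℚ + sum (λ k → Q j k * S 1 k) - survival 1 j                  ∎
      where
      open ≡-Reasoning
      *-identityˡ-+ : ∀ p → 0ℚ + 0ℚ * 0ℚ + 1ℚ * p ≡ p
      *-identityˡ-+ = solve-∀ ring
      Q·0≡0 : sum (λ k → Q j k * S 1 k) ≡ 0ℚ
      Q·0≡0 = trans (sum-cong-≗ λ k → *-zeroʳ (Q j k)) (sum-replicate-zero n)
    S-step (suc M) j = begin
      S (suc (suc M)) j + ℕtoℚ (suc (suc M)) * firstPassage G (suc (suc M)) j i
        ≡⟨ cong₂ _+_ (S-step M j) (cong (_* firstPassage G (suc (suc M)) j i) (ℕtoℚ-+ 1 (suc M))) ⟩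
      (1ℚ + A - G₁) + (1ℚ + N) * firstPassage G (suc (suc M)) j i
        ≡⟨ cong (λ f → (1ℚ + A - G₁) + f) (split N (firstPassage G (suc (suc M)) j i)) ⟩
      (1ℚ + A - G₁) + (N * firstPassage G (suc (suc M)) j i + firstPassage G (suc (suc M)) j i)
        ≡⟨ cong₂ (λ f g → (1ℚ + A - G₁) + (N * f + g)) (firstPassage-suc-suc M j) (firstPassage-survival (suc M) j) ⟩
      (1ℚ + A - G₁) + (N * B + (G₁ - G₂))
        ≡⟨ collect A G₁ N B G₂ ⟩
      1ℚ + (1ℚ * A + N * B) - G₂
        ≡⟨ cong (λ p → 1ℚ + p - G₂) (sum-linear 1ℚ N (λ k → Q j k * S (suc M) k) (λ k → Q j k * firstPassage G (suc M) k i)) ⟨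
      1ℚ + sum (λ k → 1ℚ * (Q j k * S (suc M) k) + N * (Q j k * firstPassage G (suc M) k i)) - G₂
        ≡⟨ cong (λ p → 1ℚ + p - G₂) (sum-cong-≗ λ k → factor N (Q j k) (S (suc M) k) (firstPassage G (suc M) k i)) ⟩
      1ℚ + sum (λ k → Q j k * S (suc (suc M)) k) - G₂ ∎
      where
      open ≡-Reasoning
      N = ℕtoℚ (suc M)
      A = sum (λ k → Q j k * S (suc M) k)
      B = sum (λ k → Q j k * firstPassage G (suc M) k i)
      G₁ = survival (suc M) j
      G₂ = survival (suc (suc M)) j
      split : ∀ p q → (1ℚ + p) * q ≡ p * q + q
      split = solve-∀ ring
      collect : ∀ A G₁ N B G₂ → (1ℚ + A - G₁) + (N * B + (G₁ - G₂)) ≡ 1ℚ + (1ℚ * A + N * B) - G₂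
      collect = solve-∀ ring
      factor : ∀ N q s f → 1ℚ * (q * s) + N * (q * f) ≡ q * (s + N * f)
      factor = solve-∀ ring

    -- The limit of `S-step`: a combination of null sequences is identically the difference of the
    -- two sides, so that constant is zero.
    meanFirstPassageTime-step : (m : Fin n → ℚ) → (∀ j → IsMeanFirstPassageTime G j i (m j)) →
                                ∀ j → m j ≡ 1ℚ + sum (λ k → Q j k * m k)
    meanFirstPassageTime-step m mean j = p-q≡0⇒p≡q (null-const (null-cong defect
      (null-+ (null-+ (null-neg (null-shift (null-shift (mean j))))
                      (null-sum λ k → null-*ˡ (Q j k) (null-shift (mean k))))
              (null-neg (null-shift (null-survival j))))))
      where
      open ≡-Reasoning
      C = sum (λ k → Q j k * m k)
      eliminate : ∀ A C G m → - (1ℚ + A - G - m) + (A - C) + - G ≡ m - (1ℚ + C)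
      eliminate = solve-∀ ring
      defect : ∀ M → - (S (suc (suc M)) j - m j) + sum (λ k → Q j k * (S (suc M) k - m k)) + - survival (suc M) j
                     ≡ m j - (1ℚ + C)
      defect M = begin
        - (S (suc (suc M)) j - m j) + sum (λ k → Q j k * (S (suc M) k - m k)) + - survival (suc M) j
          ≡⟨ cong₂ (λ p q → - (p - m j) + q + - survival (suc M) j) (S-step M j) (Q·-- j (S (suc M)) m) ⟩
        - (1ℚ + sum (λ k → Q j k * S (suc M) k) - survival (suc M) j - m j)
          + (sum (λ k → Q j k * S (suc M) k) - C) + - survival (suc M) j
          ≡⟨ eliminate (sum (λ k → Q j k * S (suc M) k)) C (survival (suc M) j) (m j) ⟩
        m j - (1ℚ + C) ∎

-- Cancelling a factor two, and a total reciprocal.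

p+p-injective : ∀ {p q} → p + p ≡ q + q → p ≡ q
p+p-injective {p} {q} eq = p-q≡0⇒p≡q (p*q≡0⇒q≡0 (0<a/d 2 1) (begin
  ℕtoℚ 2 * (p - q)              ≡⟨ cong (_* (p - q)) (ℕtoℚ-+ 1 1) ⟩
  (1ℚ + 1ℚ) * (p - q)           ≡⟨ double p q ⟩
  (p + p) - (q + q)             ≡⟨ cong (_- (q + q)) eq ⟩
  (q + q) - (q + q)             ≡⟨ +-inverseʳ (q + q) ⟩
  0ℚ                            ∎))
  where
  open ≡-Reasoning
  double : ∀ p q → (1ℚ + 1ℚ) * (p - q) ≡ (p + p) - (q + q)
  double = solve-∀ ring

-- The value 0 at 0 serves empty colour classes, whose weight is 0: the product of weight and
-- reciprocal is then 0, still at most 1.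
recip : ℚ → ℚ
recip p with p ℚₚ.≟ 0ℚ
... | yes _  = 0ℚ
... | no p≢0 = (1/ p) {{≢-nonZero p≢0}}

p≢0⇒p*recip≡1 : ∀ {p} → p ≢ 0ℚ → p * recip p ≡ 1ℚ
p≢0⇒p*recip≡1 {p} p≢0 with p ℚₚ.≟ 0ℚ
... | yes p≡0 = contradiction p≡0 p≢0
... | no p≢0′ = *-inverseʳ p {{≢-nonZero p≢0′}}

0<p⇒p*recip≡1 : ∀ {p} → 0ℚ < p → p * recip p ≡ 1ℚ
0<p⇒p*recip≡1 0<p = p≢0⇒p*recip≡1 λ p≡0 → <⇒≢ 0<p (sym p≡0)

p*recip≤1 : ∀ p → p * recip p ≤ 1ℚ
p*recip≤1 p with p ℚₚ.≟ 0ℚ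
... | yes _  = subst (_≤ 1ℚ) (sym (*-zeroʳ p)) (0≤a/d 1 1)
... | no p≢0 = ≤-reflexive (*-inverseʳ p {{≢-nonZero p≢0}})

0<recip : ∀ {p} → 0ℚ < p → 0ℚ < recip p
0<recip {p} 0<p with p ℚₚ.≟ 0ℚ
... | yes p≡0 = contradiction (sym p≡0) (<⇒≢ 0<p)
... | no p≢0  = positive⁻¹ ((1/ p) {{≢-nonZero p≢0}}) {{1/pos⇒pos p {{positive 0<p}}}}

-- Laplacian and Dirichlet form of a symmetric weighted graph.

module WeightedGraph {n : ℕ} (w : Fin n → Fin n → ℚ)
  (w-sym : ∀ u v → w u v ≡ w v u) (0≤w : ∀ u v → 0ℚ ≤ w u v) where

  π : Fin n → ℚ
  π u = sum (w u)

  L : (Fin n → ℚ) → Fin n → ℚ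
  L f u = sum λ v → w u v * (f u - f v)

  energy : (Fin n → ℚ) → (Fin n → ℚ) → ℚ
  energy f g = sum λ u → f u * L g u

  L-π : ∀ f u → L f u ≡ π u * f u - sum (λ v → w u v * f v)
  L-π f u = begin
    sum (λ v → w u v * (f u - f v))                      ≡⟨ sum-cong-≗ (λ v → x[y-z]≈xy-xz (w u v) (f u) (f v)) ⟩
    sum (λ v → w u v * f u - w u v * f v)                ≡⟨ sum-- (λ v → w u v * f u) (λ v → w u v * f v) ⟩
    sum (λ v → w u v * f u) - sum (λ v → w u v * f v)    ≡⟨ cong (_- sum (λ v → w u v * f v)) (*-distribʳ-sum (f u) (w u)) ⟨
    π u * f u - sum (λ v → w u v * f v)                  ∎
    where
    open ≡-Reasoning

  energy-∑∑ : ∀ f g → energy f g ≡ sum (λ u → sum (λ v → f u * (w u v * (g u - g v))))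
  energy-∑∑ f g = sum-cong-≗ λ u → *-distribˡ-sum (f u) (λ v → w u v * (g u - g v))

  -- Exchanging the summation indices in one of the two copies pairs each ordered pair of vertices
  -- with its reverse. Symmetry and positivity of the form are both read off from this expression.
  double-energy : ∀ f g → energy f g + energy f g ≡
                  sum (λ u → sum (λ v → w u v * ((f u - f v) * (g u - g v))))
  double-energy f g = begin
    energy f g + energy f g
      ≡⟨ cong₂ _+_ (energy-∑∑ f g) (trans (energy-∑∑ f g) (∑-comm (λ u v → f u * (w u v * (g u - g v))))) ⟩
    sum (λ u → sum (λ v → f u * (w u v * (g u - g v)))) + sum (λ u → sum (λ v → f v * (w v u * (g v - g u))))
      ≡⟨ ∑-distrib-+ (λ u → sum (λ v → f u * (w u v * (g u - g v)))) (λ u → sum (λ v → f v * (w v u * (g v - g u)))) ⟨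
    sum (λ u → sum (λ v → f u * (w u v * (g u - g v))) + sum (λ v → f v * (w v u * (g v - g u))))
      ≡⟨ sum-cong-≗ (λ u → ∑-distrib-+ (λ v → f u * (w u v * (g u - g v))) (λ v → f v * (w v u * (g v - g u)))) ⟨
    sum (λ u → sum (λ v → f u * (w u v * (g u - g v)) + f v * (w v u * (g v - g u))))
      ≡⟨ sum-cong-≗ (λ u → sum-cong-≗ λ v → term u v) ⟩
    sum (λ u → sum (λ v → w u v * ((f u - f v) * (g u - g v)))) ∎
    where
    open ≡-Reasoning
    factor : ∀ w f f′ g g′ → f * (w * (g - g′)) + f′ * (w * (g′ - g)) ≡ w * ((f - f′) * (g - g′))
    factor = solve-∀ ring
    term : ∀ u v → f u * (w u v * (g u - g v)) + f v * (w v u * (g v - g u)) ≡ w u v * ((f u - f v) * (g u - g v))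
    term u v = trans (cong (λ x → f u * (w u v * (g u - g v)) + f v * (x * (g v - g u))) (w-sym v u))
                     (factor (w u v) (f u) (f v) (g u) (g v))

  energy-sym : ∀ f g → energy f g ≡ energy g f
  energy-sym f g = p+p-injective (begin
    energy f g + energy f g                                       ≡⟨ double-energy f g ⟩
    sum (λ u → sum (λ v → w u v * ((f u - f v) * (g u - g v))))   ≡⟨ sum-cong-≗ (λ u → sum-cong-≗ λ v → cong (w u v *_) (*-comm (f u - f v) (g u - g v))) ⟩
    sum (λ u → sum (λ v → w u v * ((g u - g v) * (f u - f v))))   ≡⟨ double-energy g f ⟨
    energy g f + energy g f                                       ∎)
    where open ≡-Reasoning

  0≤w*[f-f]² : ∀ (f : Fin n → ℚ) u v → 0ℚ ≤ w u v * ((f u - f v) * (f u - f v))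
  0≤w*[f-f]² f u v = 0≤p*q (0≤w u v) (0≤p*p (f u - f v))

  0≤energy : ∀ f → 0ℚ ≤ energy f f
  0≤energy f = *-cancelˡ-≤-pos (1ℚ + 1ℚ) (begin
    (1ℚ + 1ℚ) * 0ℚ                 ≡⟨ *-zeroʳ (1ℚ + 1ℚ) ⟩
    0ℚ                             ≤⟨ sum-nonNeg (λ u → sum-nonNeg (0≤w*[f-f]² f u)) ⟩
    sum (λ u → sum (λ v → w u v * ((f u - f v) * (f u - f v))))  ≡⟨ double-energy f f ⟨
    energy f f + energy f f        ≡⟨ double (energy f f) ⟨
    (1ℚ + 1ℚ) * energy f f         ∎)
    where
    open ≤-Reasoning
    double : ∀ p → (1ℚ + 1ℚ) * p ≡ p + p
    double = solve-∀ ring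

  -- A harmonic function has zero energy, so each nonnegative term `w u x (f u - f x)²` vanishes and
  -- `f` cannot change along an edge of positive weight.
  harmonic⇒constant : ∀ f → (∀ u → L f u ≡ 0ℚ) → ∀ {u v} → Star (λ x y → 0ℚ < w x y) u v → f u ≡ f v
  harmonic⇒constant f harmonic nil = refl
  harmonic⇒constant f harmonic (_◅_ {u} {x} 0<w u⇝v) =
    trans (p-q≡0⇒p≡q (p*p≡0⇒p≡0 (f u - f x) (p*q≡0⇒q≡0 0<w (≤-antisym term≤0 (0≤w*[f-f]² f u x)))))
          (harmonic⇒constant f harmonic u⇝v)
    where
    open ≤-Reasoning
    energy≡0 : energy f f ≡ 0ℚ
    energy≡0 = trans (sum-cong-≗ λ u → trans (cong (f u *_) (harmonic u)) (*-zeroʳ (f u))) (sum-replicate-zero n)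
    term≤0 : w u x * ((f u - f x) * (f u - f x)) ≤ 0ℚ
    term≤0 = begin
      w u x * ((f u - f x) * (f u - f x))                           ≤⟨ ≤-sum (0≤w*[f-f]² f u) x ⟩
      sum (λ v → w u v * ((f u - f v) * (f u - f v)))               ≤⟨ ≤-sum (λ u → sum-nonNeg (0≤w*[f-f]² f u)) u ⟩
      sum (λ u → sum (λ v → w u v * ((f u - f v) * (f u - f v))))   ≡⟨ double-energy f f ⟨
      energy f f + energy f f                                       ≡⟨ cong₂ _+_ energy≡0 energy≡0 ⟩
      0ℚ                                                            ∎

  L-+ : ∀ f g u → L (λ v → f v + g v) u ≡ L f u + L g u
  L-+ f g u = trans (sum-cong-≗ λ v → distrib (w u v) (f u) (g u) (f v) (g v))
    (∑-distrib-+ (λ v → w u v * (f u - f v)) (λ v → w u v * (g u - g v)))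
    where
    distrib : ∀ w f g f′ g′ → w * (f + g - (f′ + g′)) ≡ w * (f - f′) + w * (g - g′)
    distrib = solve-∀ ring

  energy-+ : ∀ f g → energy (λ v → f v + g v) (λ v → f v + g v) ≡ energy f f + energy g g + (energy g f + energy g f)
  energy-+ f g = begin
    sum (λ u → (f u + g u) * L (λ v → f v + g v) u)
      ≡⟨ sum-cong-≗ (λ u → trans (cong ((f u + g u) *_) (L-+ f g u)) (expand (f u) (g u) (L f u) (L g u))) ⟩
    sum (λ u → (f u * L f u + g u * L g u) + (f u * L g u + g u * L f u))
      ≡⟨ ∑-distrib-+ (λ u → f u * L f u + g u * L g u) (λ u → f u * L g u + g u * L f u) ⟩
    sum (λ u → f u * L f u + g u * L g u) + sum (λ u → f u * L g u + g u * L f u)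
      ≡⟨ cong₂ _+_ (∑-distrib-+ (λ u → f u * L f u) (λ u → g u * L g u)) (∑-distrib-+ (λ u → f u * L g u) (λ u → g u * L f u)) ⟩
    energy f f + energy g g + (energy f g + energy g f)
      ≡⟨ cong (λ e → energy f f + energy g g + (e + energy g f)) (energy-sym f g) ⟩
    energy f f + energy g g + (energy g f + energy g f) ∎
    where
    open ≡-Reasoning
    expand : ∀ f g a b → (f + g) * (a + b) ≡ (f * a + g * b) + (f * b + g * a)
    expand = solve-∀ ring

  -- Without cross terms only the diagonal part of `L` contributes, so the energy depends on the
  -- edges through `π` alone.
  energy-independent : ∀ y → (∀ u v → w u v * (y u * y v) ≡ 0ℚ) → energy y y ≡ sum (λ u → π u * (y u * y u))
  energy-independent y indep = trans (energy-∑∑ y y) (sum-cong-≗ λ u →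
    trans (sum-cong-≗ λ v → term u v) (sym (*-distribʳ-sum (y u * y u) (w u))))
    where
    open ≡-Reasoning
    split : ∀ w y y′ → y * (w * (y - y′)) ≡ w * (y * y) - w * (y * y′)
    split = solve-∀ ring
    term : ∀ u v → y u * (w u v * (y u - y v)) ≡ w u v * (y u * y u)
    term u v = begin
      y u * (w u v * (y u - y v))                 ≡⟨ split (w u v) (y u) (y v) ⟩
      w u v * (y u * y u) - w u v * (y u * y v)   ≡⟨ cong (λ p → w u v * (y u * y u) - p) (indep u v) ⟩
      w u v * (y u * y u) - 0ℚ                    ≡⟨ +-identityʳ (w u v * (y u * y u)) ⟩
      w u v * (y u * y u)                         ∎

  -- Solutions of the Poisson equation and the Kemeny sum.

  module HittingTimes
    (π-total : sum π ≡ 1ℚ)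
    (h : Fin n → Fin n → ℚ)
    (h-target : ∀ i → h i i ≡ 0ℚ)
    (L-h : ∀ i u → L (h i) u ≡ π u - δ u i) where

    mean : (Fin n → ℚ) → ℚ
    mean f = sum λ u → π u * f u

    kemeny : Fin n → ℚ
    kemeny u = sum λ i → π i * h i u

    -- Pairing `x` with the Poisson equation: `h i` represents evaluation at `i`, up to sign and the
    -- mean.
    energy-h : ∀ x i → energy x (h i) ≡ mean x - x i
    energy-h x i = begin
      sum (λ u → x u * L (h i) u)            ≡⟨ sum-cong-≗ (λ u → trans (cong (x u *_) (L-h i u)) (distrib (x u) (π u) (δ u i))) ⟩
      sum (λ u → π u * x u - δ u i * x u)    ≡⟨ sum-- (λ u → π u * x u) (λ u → δ u i * x u) ⟩
      mean x - sum (λ u → δ u i * x u)       ≡⟨ cong (λ p → mean x - p) (sum-δ i x) ⟩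
      mean x - x i                           ∎
      where
      open ≡-Reasoning
      distrib : ∀ x p d → x * (p - d) ≡ p * x - d * x
      distrib = solve-∀ ring

    energy-hh : ∀ i → energy (h i) (h i) ≡ mean (h i)
    energy-hh i = trans (energy-h (h i) i) (trans (cong (λ p → mean (h i) - p) (h-target i)) (+-identityʳ (mean (h i))))

    -- Positivity of the energy of h i + y, for any test function y.
    test-function-bound : ∀ y i → (y i - mean y) + (y i - mean y) - energy y y ≤ mean (h i)
    test-function-bound y i = 0≤q-p⇒p≤q (subst (0ℚ ≤_) (begin
      energy (λ u → h i u + y u) (λ u → h i u + y u)
        ≡⟨ energy-+ (h i) y ⟩
      energy (h i) (h i) + energy y y + (energy y (h i) + energy y (h i))
        ≡⟨ cong₂ (λ p q → p + energy y y + (q + q)) (energy-hh i) (energy-h y i) ⟩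
      mean (h i) + energy y y + ((mean y - y i) + (mean y - y i))
        ≡⟨ rearrange (mean (h i)) (energy y y) (mean y) (y i) ⟩
      mean (h i) - ((y i - mean y) + (y i - mean y) - energy y y) ∎) (0≤energy (λ u → h i u + y u)))
      where
      open ≡-Reasoning
      rearrange : ∀ a e m y → a + e + ((m - y) + (m - y)) ≡ a - ((y - m) + (y - m) - e)
      rearrange = solve-∀ ring

    -- Averaging the Poisson equations over the target with weights `π` leaves `π u - π u` on the
    -- right. This harmonicity is what makes the Kemeny sum independent of the starting vertex.
    L-kemeny : ∀ u → L kemeny u ≡ 0ℚ
    L-kemeny u = begin
      sum (λ v → w u v * (kemeny u - kemeny v))
        ≡⟨ sum-cong-≗ (λ v → cong (w u v *_) (sum-- (λ i → π i * h i u) (λ i → π i * h i v))) ⟨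
      sum (λ v → w u v * sum (λ i → π i * h i u - π i * h i v))
        ≡⟨ sum-cong-≗ (λ v → *-distribˡ-sum (w u v) (λ i → π i * h i u - π i * h i v)) ⟩
      sum (λ v → sum (λ i → w u v * (π i * h i u - π i * h i v)))
        ≡⟨ ∑-comm (λ v i → w u v * (π i * h i u - π i * h i v)) ⟩
      sum (λ i → sum (λ v → w u v * (π i * h i u - π i * h i v)))
        ≡⟨ sum-cong-≗ (λ i → sum-cong-≗ λ v → factor (w u v) (π i) (h i u) (h i v)) ⟩
      sum (λ i → sum (λ v → π i * (w u v * (h i u - h i v))))
        ≡⟨ sum-cong-≗ (λ i → *-distribˡ-sum (π i) (λ v → w u v * (h i u - h i v))) ⟨
      sum (λ i → π i * L (h i) u)
        ≡⟨ sum-cong-≗ (λ i → trans (cong (π i *_) (trans (L-h i u) (cong (λ d → π u - d) (δ-sym u i)))) (distrib (π i) (π u) (δ i u))) ⟩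
      sum (λ i → π u * π i - δ i u * π i)
        ≡⟨ sum-- (λ i → π u * π i) (λ i → δ i u * π i) ⟩
      sum (λ i → π u * π i) - sum (λ i → δ i u * π i)
        ≡⟨ cong₂ _-_ (trans (sym (*-distribˡ-sum (π u) π)) (trans (cong (π u *_) π-total) (*-identityʳ (π u)))) (sum-δ u π) ⟩
      π u - π u
        ≡⟨ +-inverseʳ (π u) ⟩
      0ℚ ∎
      where
      open ≡-Reasoning
      factor : ∀ w p a b → w * (p * a - p * b) ≡ p * (w * (a - b))
      factor = solve-∀ ring
      distrib : ∀ p q d → p * (q - d) ≡ q * p - d * p
      distrib = solve-∀ ring

    -- A constant function equals its own `π`-average; exchanging the two sums then turns it into
    -- the average of `mean (h i)`, that is, of the energies of the `h i`.
    kemeny-average : (∀ u v → Star (λ x y → 0ℚ < w x y) u v) → ∀ j → sum (λ i → π i * mean (h i)) ≡ kemeny j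
    kemeny-average connected j = begin
      sum (λ i → π i * mean (h i))                     ≡⟨ sum-cong-≗ (λ i → *-distribˡ-sum (π i) (λ u → π u * h i u)) ⟩
      sum (λ i → sum (λ u → π i * (π u * h i u)))      ≡⟨ ∑-comm (λ i u → π i * (π u * h i u)) ⟩
      sum (λ u → sum (λ i → π i * (π u * h i u)))      ≡⟨ sum-cong-≗ (λ u → sum-cong-≗ λ i → swap (π i) (π u) (h i u)) ⟩
      sum (λ u → sum (λ i → π u * (π i * h i u)))      ≡⟨ sum-cong-≗ (λ u → *-distribˡ-sum (π u) (λ i → π i * h i u)) ⟨
      sum (λ u → π u * kemeny u)                       ≡⟨ sum-cong-≗ (λ u → cong (π u *_) (harmonic⇒constant kemeny L-kemeny (connected u j))) ⟩
      sum (λ u → π u * kemeny j)                       ≡⟨ *-distribʳ-sum (kemeny j) π ⟨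
      sum π * kemeny j                                 ≡⟨ cong (_* kemeny j) π-total ⟩
      1ℚ * kemeny j                                    ≡⟨ *-identityˡ (kemeny j) ⟩
      kemeny j                                         ∎
      where
      open ≡-Reasoning
      swap : ∀ p q r → p * (q * r) ≡ q * (p * r)
      swap = solve-∀ ring

    -- Test functions supported on colour classes.

    module Coloured {k : ℕ} (c : Fin n → Fin k)
      (proper : ∀ u v → c u ≡ c v → w u v ≡ 0ℚ)
      (0<π : ∀ u → 0ℚ < π u)
      (κ : ℚ) (kκ≡1 : ℕtoℚ k * κ ≡ 1ℚ) where

      class : Fin k → Fin n → ℚ
      class a u = δ a (c u)

      V : Fin k → ℚ
      V a = sum λ u → π u * class a u

      r : Fin k → ℚ
      r a = recip (V a)

      0≤π*class : ∀ a u → 0ℚ ≤ π u * class a u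
      0≤π*class a u with a ≟ c u
      ... | yes _ = subst (0ℚ ≤_) (sym (*-identityʳ (π u))) (<⇒≤ (0<π u))
      ... | no _  = ≤-reflexive (sym (*-zeroʳ (π u)))

      V*r≡1 : ∀ i → V (c i) * r (c i) ≡ 1ℚ
      V*r≡1 i = 0<p⇒p*recip≡1 (begin-strict
        0ℚ                     <⟨ 0<π i ⟩
        π i                    ≡⟨ *-identityʳ (π i) ⟨
        π i * 1ℚ               ≡⟨ cong (π i *_) (δ-refl (c i)) ⟨
        π i * class (c i) i    ≤⟨ ≤-sum (0≤π*class (c i)) i ⟩
        V (c i)                ∎)
        where open ≤-Reasoning

      -- Grouped by colour, the sum has one term `V a * r a` per class: 1 if the class is occupied,
      -- 0 if it is empty.
      ∑πr≤k : sum (λ i → π i * r (c i)) ≤ ℕtoℚ k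
      ∑πr≤k = begin
        sum (λ i → π i * r (c i))                              ≡⟨ sum-cong-≗ (λ i → cong (π i *_) (sum-δ (c i) r)) ⟨
        sum (λ i → π i * sum (λ a → class a i * r a))          ≡⟨ sum-cong-≗ (λ i → *-distribˡ-sum (π i) (λ a → class a i * r a)) ⟩
        sum (λ i → sum (λ a → π i * (class a i * r a)))        ≡⟨ ∑-comm (λ i a → π i * (class a i * r a)) ⟩
        sum (λ a → sum (λ i → π i * (class a i * r a)))        ≡⟨ sum-cong-≗ (λ a → sum-cong-≗ λ i → *-assoc (π i) (class a i) (r a)) ⟨
        sum (λ a → sum (λ i → π i * class a i * r a))          ≡⟨ sum-cong-≗ (λ a → *-distribʳ-sum (r a) (λ i → π i * class a i)) ⟨
        sum (λ a → V a * r a)                                  ≤⟨ sum-mono (λ a → p*recip≤1 (V a)) ⟩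
        sum {k} (λ _ → 1ℚ)                                     ≡⟨ sum-1 k ⟩
        ℕtoℚ k                                                 ∎
        where open ≤-Reasoning

      module _ (i : Fin n) where

        R E : ℚ
        R = r (c i)
        E = recip (π i)

        y : Fin n → ℚ
        y u = E * δ u i + (- (κ * R)) * class (c i) u

        y-off-class : ∀ {u} → c i ≢ c u → y u ≡ 0ℚ
        y-off-class {u} ci≢cu = trans
          (cong₂ (λ p q → E * p + (- (κ * R)) * q) (δ-≢ λ u≡i → ci≢cu (cong c (sym u≡i))) (δ-≢ ci≢cu))
          (zeros E (- (κ * R)))
          where
          zeros : ∀ p q → p * 0ℚ + q * 0ℚ ≡ 0ℚ
          zeros = solve-∀ ring

        y-independent : ∀ u v → w u v * (y u * y v) ≡ 0ℚ
        y-independent u v = by-class (c i ≟ c u) (c i ≟ c v)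
          where
          by-class : Dec (c i ≡ c u) → Dec (c i ≡ c v) → w u v * (y u * y v) ≡ 0ℚ
          by-class (yes ci≡cu) (yes ci≡cv) =
            trans (cong (_* (y u * y v)) (proper u v (trans (sym ci≡cu) ci≡cv))) (*-zeroˡ (y u * y v))
          by-class (no ci≢cu) _ =
            trans (cong (λ p → w u v * (p * y v)) (y-off-class ci≢cu)) (zeros (w u v) (y v))
            where
            zeros : ∀ p q → p * (0ℚ * q) ≡ 0ℚ
            zeros = solve-∀ ring
          by-class _ (no ci≢cv) =
            trans (cong (λ p → w u v * (y u * p)) (y-off-class ci≢cv)) (zeros (w u v) (y u))
            where
            zeros : ∀ p q → p * (q * 0ℚ) ≡ 0ℚ
            zeros = solve-∀ ring

        -- Both indicators are idempotent and `i` lies in its own class, so their product is again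
        -- `δ u i` and the square is a combination of the same two indicators.
        y² : ∀ u → y u * y u ≡ (E * E - (κ * R * E + κ * R * E)) * δ u i + κ * R * (κ * R) * class (c i) u
        y² u = by-cases (u ≟ i) (c i ≟ c u)
          where
          by-cases : Dec (u ≡ i) → Dec (c i ≡ c u) →
            y u * y u ≡ (E * E - (κ * R * E + κ * R * E)) * δ u i + κ * R * (κ * R) * class (c i) u
          by-cases (yes refl) _ rewrite δ-refl i | δ-refl (c i) = at-i E (κ * R)
            where
            at-i : ∀ e t → (e * 1ℚ + (- t) * 1ℚ) * (e * 1ℚ + (- t) * 1ℚ) ≡ (e * e - (t * e + t * e)) * 1ℚ + t * t * 1ℚ
            at-i = solve-∀ ring
          by-cases (no u≢i) (yes ci≡cu) rewrite δ-≢ u≢i | ci≡cu | δ-refl (c u) = in-class E (κ * r (c u))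
            where
            in-class : ∀ e t → (e * 0ℚ + (- t) * 1ℚ) * (e * 0ℚ + (- t) * 1ℚ) ≡ (e * e - (t * e + t * e)) * 0ℚ + t * t * 1ℚ
            in-class = solve-∀ ring
          by-cases (no u≢i) (no ci≢cu) rewrite δ-≢ u≢i | δ-≢ ci≢cu = off-class E (κ * R)
            where
            off-class : ∀ e t → (e * 0ℚ + (- t) * 0ℚ) * (e * 0ℚ + (- t) * 0ℚ) ≡ (e * e - (t * e + t * e)) * 0ℚ + t * t * 0ℚ
            off-class = solve-∀ ring

        -- The coefficients are left general because both `y` and its square have this form.
        mean-combination : ∀ p q (f : Fin n → ℚ) → (∀ u → f u ≡ p * δ u i + q * class (c i) u) →
                           mean f ≡ p * π i + q * V (c i)
        mean-combination p q f f≡ = begin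
          sum (λ u → π u * f u)
            ≡⟨ sum-cong-≗ (λ u → trans (cong (π u *_) (f≡ u)) (distrib p q (π u) (δ u i) (class (c i) u))) ⟩
          sum (λ u → p * (δ u i * π u) + q * (π u * class (c i) u))
            ≡⟨ sum-linear p q (λ u → δ u i * π u) (λ u → π u * class (c i) u) ⟩
          p * sum (λ u → δ u i * π u) + q * V (c i)
            ≡⟨ cong (λ s → p * s + q * V (c i)) (sum-δ i π) ⟩
          p * π i + q * V (c i) ∎
          where
          open ≡-Reasoning
          distrib : ∀ p q x d l → x * (p * d + q * l) ≡ p * (d * x) + q * (x * l)
          distrib = solve-∀ ring

        vertex-bound : 1ℚ - (1ℚ + 1ℚ) * (1ℚ - κ) * π i - κ * κ * (π i * R) ≤ π i * mean (h i)
        vertex-bound = begin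
          1ℚ - (1ℚ + 1ℚ) * (1ℚ - κ) * π i - κ * κ * (π i * R)
            ≡⟨ sym weigh ⟩
          π i * ((y i - mean y) + (y i - mean y) - energy y y)
            ≤⟨ *-monoˡ-≤-nonNeg (π i) {{nonNegative (<⇒≤ (0<π i))}} (test-function-bound y i) ⟩
          π i * mean (h i) ∎
          where
          open ≤-Reasoning
          πE≡1 : π i * E ≡ 1ℚ
          πE≡1 = 0<p⇒p*recip≡1 (0<π i)
          y-at-i : y i ≡ E - κ * R
          y-at-i = trans (cong₂ (λ p q → E * p + (- (κ * R)) * q) (δ-refl i) (δ-refl (c i))) (ones E (κ * R))
            where
            ones : ∀ e t → e * 1ℚ + (- t) * 1ℚ ≡ e - t
            ones = solve-∀ ring
          energy-y : energy y y ≡ (E * E - (κ * R * E + κ * R * E)) * π i + κ * R * (κ * R) * V (c i)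
          energy-y = trans (energy-independent y y-independent) (mean-combination (E * E - (κ * R * E + κ * R * E)) (κ * R * (κ * R)) (λ u → y u * y u) y²)
          -- The terms are grouped so that `e` occurs only in `p * e` and `v` only in `v * r`. Both
          -- products are 1, which the ring solver cannot know; they are replaced before `collapse`.
          expand : ∀ p e k r v →
            p * ((e - k * r - (e * p + (- (k * r)) * v)) + (e - k * r - (e * p + (- (k * r)) * v))
                 - ((e * e - (k * r * e + k * r * e)) * p + k * r * (k * r) * v))
            ≡ ((1ℚ + 1ℚ) * (p * e) - (p * e) * (p * e))
              + (- ((1ℚ + 1ℚ) * k * r * p + (1ℚ + 1ℚ) * p * (p * e) - (1ℚ + 1ℚ) * k * p * (v * r)
              - (1ℚ + 1ℚ) * k * r * p * (p * e) + k * k * (p * r) * (v * r)))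
          expand = solve-∀ ring
          collapse : ∀ p k r →
            ((1ℚ + 1ℚ) * 1ℚ - 1ℚ * 1ℚ)
              + (- ((1ℚ + 1ℚ) * k * r * p + (1ℚ + 1ℚ) * p * 1ℚ - (1ℚ + 1ℚ) * k * p * 1ℚ
              - (1ℚ + 1ℚ) * k * r * p * 1ℚ + k * k * (p * r) * 1ℚ))
            ≡ 1ℚ - (1ℚ + 1ℚ) * (1ℚ - k) * p - k * k * (p * r)
          collapse = solve-∀ ring
          weigh : π i * ((y i - mean y) + (y i - mean y) - energy y y)
                  ≡ 1ℚ - (1ℚ + 1ℚ) * (1ℚ - κ) * π i - κ * κ * (π i * R)
          weigh = trans
            (cong₂ (λ d e → π i * (d + d - e))
              (cong₂ _-_ y-at-i (mean-combination E (- (κ * R)) y λ u → refl)) energy-y)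
            (trans (expand (π i) E κ R (V (c i)))
            (trans (cong₂ (λ a b → ((1ℚ + 1ℚ) * a - a * a)
                + (- ((1ℚ + 1ℚ) * κ * R * π i + (1ℚ + 1ℚ) * π i * a - (1ℚ + 1ℚ) * κ * π i * b
                - (1ℚ + 1ℚ) * κ * R * π i * a + κ * κ * (π i * R) * b))) πE≡1 (V*r≡1 i))
              (collapse (π i) κ R)))

      kemeny-bound : ℕtoℚ n - (1ℚ + 1ℚ) + κ ≤ sum (λ i → π i * mean (h i))
      kemeny-bound = begin
        ℕtoℚ n - (1ℚ + 1ℚ) + κ
          -- The target is read as `n - 2 (1 - κ) - κ`; its last `κ` becomes `κ² k`, ready for the
          -- bound on the number of occupied classes.
          ≡⟨ unit-product (ℕtoℚ n) κ ⟩
        ℕtoℚ n - a * 1ℚ - 1ℚ * κ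
          ≡⟨ cong₂ (λ p q → ℕtoℚ n - a * p - q * κ) π-total kκ≡1 ⟨
        ℕtoℚ n - a * sum π - ℕtoℚ k * κ * κ
          ≡⟨ cong (λ p → ℕtoℚ n - a * sum π - p) (commute (ℕtoℚ k) κ) ⟩
        ℕtoℚ n - a * sum π - κ * κ * ℕtoℚ k
          ≤⟨ +-monoʳ-≤ (ℕtoℚ n - a * sum π) (neg-antimono-≤ (*-monoˡ-≤-nonNeg (κ * κ) {{nonNegative (0≤p*p κ)}} ∑πr≤k)) ⟩
        ℕtoℚ n - a * sum π - κ * κ * sum (λ i → π i * r (c i))
          ≡⟨ cong₂ _-_ (cong₂ _-_ (sym (sum-1 n)) (*-distribˡ-sum a π)) (*-distribˡ-sum (κ * κ) (λ i → π i * r (c i))) ⟩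
        sum {n} (λ _ → 1ℚ) - sum (λ i → a * π i) - sum (λ i → κ * κ * (π i * r (c i)))
          ≡⟨ cong (_- sum (λ i → κ * κ * (π i * r (c i)))) (sum-- (λ _ → 1ℚ) (λ i → a * π i)) ⟨
        sum (λ i → 1ℚ - a * π i) - sum (λ i → κ * κ * (π i * r (c i)))
          ≡⟨ sum-- (λ i → 1ℚ - a * π i) (λ i → κ * κ * (π i * r (c i))) ⟨
        sum (λ i → 1ℚ - a * π i - κ * κ * (π i * r (c i)))
          ≤⟨ sum-mono vertex-bound ⟩
        sum (λ i → π i * mean (h i)) ∎
        where
        open ≤-Reasoning
        a = (1ℚ + 1ℚ) * (1ℚ - κ)
        unit-product : ∀ n κ → n - (1ℚ + 1ℚ) + κ ≡ n - (1ℚ + 1ℚ) * (1ℚ - κ) * 1ℚ - 1ℚ * κ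
        unit-product = solve-∀ ring
        commute : ∀ k κ → k * κ * κ ≡ κ * κ * k
        commute = solve-∀ ring

-- Adjacency, degrees and transition probabilities of a graph.

module _ {n : ℕ} (G : Graph n) where
  open Graph G using (Adj; adj?)

  adjacency-sym : ∀ u v → adjacency G u v ≡ adjacency G v u
  adjacency-sym u v with adj? u v | adj? v u
  ... | yes _   | yes _   = refl
  ... | no _    | no _    = refl
  ... | yes u∼v | no v≁u  = contradiction (Graph.sym G u∼v) v≁u
  ... | no u≁v  | yes v∼u = contradiction (Graph.sym G v∼u) u≁v

  Adj⇒adjacency≡1 : ∀ {u v} → Adj u v → adjacency G u v ≡ 1
  Adj⇒adjacency≡1 {u} {v} u∼v with adj? u v
  ... | yes _  = refl
  ... | no u≁v = contradiction u∼v u≁v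

  ¬Adj⇒adjacency≡0 : ∀ {u v} → ¬ Adj u v → adjacency G u v ≡ 0
  ¬Adj⇒adjacency≡0 {u} {v} u≁v with adj? u v
  ... | yes u∼v = contradiction u∼v u≁v
  ... | no _    = refl

  0≤transition : ∀ u v → 0ℚ ≤ transition G u v
  0≤transition u v with degree G u
  ... | zero  = ≤-refl
  ... | suc d = 0≤a/d (adjacency G u v) (suc d)

  transition*degree : ∀ u v → degree G u ≢ 0 → transition G u v * ℕtoℚ (degree G u) ≡ ℕtoℚ (adjacency G u v)
  transition*degree u v d≢0 with degree G u
  ... | zero  = contradiction refl d≢0
  ... | suc d = [a/d]*d≡a (adjacency G u v) (suc d)

  -- Order at least two enters here: a path to some other vertex must begin with an edge.
  connected⇒neighbour : 2 ℕ.≤ n → Connected G → ∀ u → ∃[ v ] Adj u v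
  connected⇒neighbour 2≤n connected u = let v , u≢v = other 2≤n u in first-step u≢v (connected u v)
    where
    other : ∀ {n} → 2 ℕ.≤ n → (u : Fin n) → ∃[ v ] u ≢ v
    other (ℕ.s≤s (ℕ.s≤s _)) zero    = suc zero , λ ()
    other (ℕ.s≤s (ℕ.s≤s _)) (suc u) = zero , λ ()
    first-step : ∀ {u v} → u ≢ v → Star Adj u v → ∃[ x ] Adj u x
    first-step u≢v nil       = contradiction refl u≢v
    first-step u≢v (u∼x ◅ _) = _ , u∼x

-- The simple random walk as a reversible chain.

module SimpleRandomWalk {n : ℕ} (G : Graph n) (connected : Connected G)
  (neighbour : ∀ u → ∃[ v ] Graph.Adj G u v) (root : Fin n) where

  open Graph G using (Adj)

  A : Fin n → Fin n → ℚ
  A u v = ℕtoℚ (adjacency G u v)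

  P : Fin n → Fin n → ℚ
  P = transition G

  d : Fin n → ℚ
  d u = ℕtoℚ (degree G u)

  ∑A≡d : ∀ u → sum (A u) ≡ d u
  ∑A≡d u = sym (ℕtoℚ-sum (adjacency G u))

  Adj⇒A≡1 : ∀ {u v} → Adj u v → A u v ≡ 1ℚ
  Adj⇒A≡1 u∼v = cong ℕtoℚ (Adj⇒adjacency≡1 G u∼v)

  0<d : ∀ u → 0ℚ < d u
  0<d u = let v , u∼v = neighbour u in begin-strict
    0ℚ          <⟨ 0<a/d 1 1 ⟩
    1ℚ          ≡⟨ Adj⇒A≡1 u∼v ⟨
    A u v       ≤⟨ ≤-sum (λ x → 0≤ℕtoℚ (adjacency G u x)) v ⟩
    sum (A u)   ≡⟨ ∑A≡d u ⟩
    d u         ∎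
    where open ≤-Reasoning

  P*d≡A : ∀ u v → P u v * d u ≡ A u v
  P*d≡A u v = transition*degree G u v λ deg≡0 → <⇒≢ (0<d u) (sym (cong ℕtoℚ deg≡0))

  P-row : ∀ u → sum (P u) ≡ 1ℚ
  P-row u = p-q≡0⇒p≡q (p*q≡0⇒q≡0 (0<d u) (begin
    d u * (sum (P u) - 1ℚ)                ≡⟨ distrib (d u) (sum (P u)) ⟩
    sum (P u) * d u - d u                 ≡⟨ cong (_- d u) (*-distribʳ-sum (d u) (P u)) ⟩
    sum (λ v → P u v * d u) - d u         ≡⟨ cong (_- d u) (trans (sum-cong-≗ (P*d≡A u)) (∑A≡d u)) ⟩
    d u - d u                             ≡⟨ +-inverseʳ (d u) ⟩
    0ℚ                                    ∎))
    where
    open ≡-Reasoning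
    distrib : ∀ p q → p * (q - 1ℚ) ≡ q * p - p
    distrib = solve-∀ ring

  edge⇒0<P : ∀ {u v} → Adj u v → 0ℚ < P u v
  edge⇒0<P {u} {v} u∼v = ≤∧≢⇒< (0≤transition G u v) λ 0≡P → 1≢0 (begin
    1ℚ              ≡⟨ Adj⇒A≡1 u∼v ⟨
    A u v           ≡⟨ P*d≡A u v ⟨
    P u v * d u     ≡⟨ cong (_* d u) 0≡P ⟨
    0ℚ * d u        ≡⟨ *-zeroˡ (d u) ⟩
    0ℚ              ∎)
    where open ≡-Reasoning

  vol⁻¹ : ℚ
  vol⁻¹ = recip (sum d)

  0<vol : 0ℚ < sum d
  0<vol = <-≤-trans (0<d root) (≤-sum (λ u → <⇒≤ (0<d u)) root)

  0<vol⁻¹ : 0ℚ < vol⁻¹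
  0<vol⁻¹ = 0<recip 0<vol

  w : Fin n → Fin n → ℚ
  w u v = A u v * vol⁻¹

  w-sym : ∀ u v → w u v ≡ w v u
  w-sym u v = cong (λ a → ℕtoℚ a * vol⁻¹) (adjacency-sym G u v)

  0≤w : ∀ u v → 0ℚ ≤ w u v
  0≤w u v = 0≤p*q (0≤ℕtoℚ (adjacency G u v)) (<⇒≤ 0<vol⁻¹)

  open WeightedGraph w w-sym 0≤w

  π≡d/vol : ∀ u → π u ≡ d u * vol⁻¹
  π≡d/vol u = trans (sym (*-distribʳ-sum vol⁻¹ (A u))) (cong (_* vol⁻¹) (∑A≡d u))

  0<π : ∀ u → 0ℚ < π u
  0<π u = subst (0ℚ <_) (sym (π≡d/vol u)) (0<p*q (0<d u) 0<vol⁻¹)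

  π-total : sum π ≡ 1ℚ
  π-total = begin
    sum π                         ≡⟨ sum-cong-≗ π≡d/vol ⟩
    sum (λ u → d u * vol⁻¹)       ≡⟨ *-distribʳ-sum vol⁻¹ d ⟨
    sum d * vol⁻¹                 ≡⟨ 0<p⇒p*recip≡1 0<vol ⟩
    1ℚ                            ∎
    where open ≡-Reasoning

  -- Detailed balance: the stationary flow along an edge is the symmetric weight. It yields
  -- invariance of `π` and translates first-step equations into statements about `L`.
  π*P≡w : ∀ u v → π u * P u v ≡ w u v
  π*P≡w u v = begin
    π u * P u v               ≡⟨ cong (_* P u v) (π≡d/vol u) ⟩
    d u * vol⁻¹ * P u v       ≡⟨ rearrange (d u) vol⁻¹ (P u v) ⟩
    P u v * d u * vol⁻¹       ≡⟨ cong (_* vol⁻¹) (P*d≡A u v) ⟩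
    w u v                     ∎
    where
    open ≡-Reasoning
    rearrange : ∀ d x p → d * x * p ≡ p * d * x
    rearrange = solve-∀ ring

  π-invariant : ∀ i → sum (λ j → π j * P j i) ≡ π i
  π-invariant i = sum-cong-≗ λ j → trans (π*P≡w j i) (w-sym j i)

  w-connected : ∀ u v → Star (λ x y → 0ℚ < w x y) u v
  w-connected u v = gmap (λ x → x)
    (λ x∼y → subst (0ℚ <_) (sym (trans (cong (_* vol⁻¹) (Adj⇒A≡1 x∼y)) (*-identityˡ vol⁻¹))) 0<vol⁻¹) (connected u v)

  w-proper : ∀ {k} ((c , _) : Colorable G k) → ∀ u v → c u ≡ c v → w u v ≡ 0ℚ
  w-proper (c , proper) u v cu≡cv =
    trans (cong (λ a → ℕtoℚ a * vol⁻¹) (¬Adj⇒adjacency≡0 G λ u∼v → proper u∼v cu≡cv)) (*-zeroˡ vol⁻¹)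

  -- Mean first passage times, Kac's formula and the Poisson equation.

  module Means (m : Fin n → Fin n → ℚ) (mean-m : ∀ j i → IsMeanFirstPassageTime G j i (m j i)) where

    -- `m i i` is a mean return time; removing it at the target turns first passage times into
    -- hitting times. The target comes first in `h` and second in `m`.
    h : Fin n → Fin n → ℚ
    h i u = m u i - δ u i * m i i

    h-target : ∀ i → h i i ≡ 0ℚ
    h-target i = trans (cong (λ p → m i i - p * m i i) (δ-refl i)) (cancel (m i i))
      where
      cancel : ∀ p → p - 1ℚ * p ≡ 0ℚ
      cancel = solve-∀ ring

    -- Killing the walk at `i` has the same effect as assigning the value 0 there, so `Q` applied to
    -- `m` is `P` applied to `h`.
    m-step : ∀ j i → m j i ≡ 1ℚ + sum (λ k → P j k * h i k)
    m-step j i = trans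
      (FP.meanFirstPassageTime-step i (λ u → connected u i) (λ u → m u i) (λ u → mean-m u i) j)
      (cong (_+_ 1ℚ) (sum-cong-≗ killed))
      where
      module FP = FirstPassage G (0≤transition G) P-row edge⇒0<P neighbour
      stopped : ∀ p m → 0ℚ * m ≡ p * (m - 1ℚ * m)
      stopped = solve-∀ ring
      moving : ∀ p m m′ → p * m ≡ p * (m - 0ℚ * m′)
      moving = solve-∀ ring
      killed : ∀ k → FP.Q i j k * m k i ≡ P j k * h i k
      killed k with k ≟ i
      ... | yes refl = stopped (P j k) (m k k)
      ... | no _     = moving (P j k) (m k i) (m i i)

    -- Kac's formula. Averaging `m-step` over `μ` gives `X = 1 + (X - μ i * m i i)`. It is proved
    -- for any invariant `μ` so that two such distributions can be compared.
    stationary⇒return : ∀ μ → sum μ ≡ 1ℚ → (∀ i → sum (λ j → μ j * P j i) ≡ μ i) → ∀ i → μ i * m i i ≡ 1ℚ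
    stationary⇒return μ total invariant i = p-q≡0⇒p≡q (begin
      μ i * m i i - 1ℚ
        ≡⟨ isolate X (μ i * m i i) ⟩
      X - (1ℚ + (X - μ i * m i i))
        ≡⟨ cong (λ p → p - (1ℚ + (X - μ i * m i i))) X≡ ⟩
      (1ℚ + (X - μ i * m i i)) - (1ℚ + (X - μ i * m i i))
        ≡⟨ +-inverseʳ (1ℚ + (X - μ i * m i i)) ⟩
      0ℚ ∎)
      where
      open ≡-Reasoning
      X = sum λ j → μ j * m j i
      isolate : ∀ x p → p - 1ℚ ≡ x - (1ℚ + (x - p))
      isolate = solve-∀ ring
      distrib : ∀ p q → p * (1ℚ + q) ≡ p + p * q
      distrib = solve-∀ ring
      expand : ∀ p m d m′ → p * (m - d * m′) ≡ p * m - d * (p * m′)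
      expand = solve-∀ ring
      X≡ : X ≡ 1ℚ + (X - μ i * m i i)
      X≡ = begin
        sum (λ j → μ j * m j i)
          ≡⟨ sum-cong-≗ (λ j → trans (cong (μ j *_) (m-step j i)) (distrib (μ j) (sum (λ k → P j k * h i k)))) ⟩
        sum (λ j → μ j + μ j * sum (λ k → P j k * h i k))
          ≡⟨ ∑-distrib-+ μ (λ j → μ j * sum (λ k → P j k * h i k)) ⟩
        sum μ + sum (λ j → μ j * sum (λ k → P j k * h i k))
          ≡⟨ cong₂ _+_ total (sum-cong-≗ λ j → *-distribˡ-sum (μ j) (λ k → P j k * h i k)) ⟩
        1ℚ + sum (λ j → sum (λ k → μ j * (P j k * h i k)))
          ≡⟨ cong (_+_ 1ℚ) (∑-comm (λ j k → μ j * (P j k * h i k))) ⟩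
        1ℚ + sum (λ k → sum (λ j → μ j * (P j k * h i k)))
          ≡⟨ cong (_+_ 1ℚ) (sum-cong-≗ λ k → trans (sum-cong-≗ λ j → sym (*-assoc (μ j) (P j k) (h i k))) (sym (*-distribʳ-sum (h i k) (λ j → μ j * P j k)))) ⟩
        1ℚ + sum (λ k → sum (λ j → μ j * P j k) * h i k)
          ≡⟨ cong (_+_ 1ℚ) (sum-cong-≗ λ k → trans (cong (_* h i k) (invariant k)) (expand (μ k) (m k i) (δ k i) (m i i))) ⟩
        1ℚ + sum (λ k → μ k * m k i - δ k i * (μ k * m i i))
          ≡⟨ cong (_+_ 1ℚ) (sum-- (λ k → μ k * m k i) (λ k → δ k i * (μ k * m i i))) ⟩
        1ℚ + (X - sum (λ k → δ k i * (μ k * m i i)))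
          ≡⟨ cong (λ p → 1ℚ + (X - p)) (sum-δ i (λ k → μ k * m i i)) ⟩
        1ℚ + (X - μ i * m i i) ∎

    π-return : ∀ i → π i * m i i ≡ 1ℚ
    π-return = stationary⇒return π π-total π-invariant

    -- By Kac's formula both masses at `i` are inverse to the same mean return time.
    stationary-unique : ∀ {μ} → IsStationary G μ → ∀ i → μ i ≡ π i
    stationary-unique {μ} stationary i = begin
      μ i                     ≡⟨ *-identityʳ (μ i) ⟨
      μ i * 1ℚ                ≡⟨ cong (μ i *_) (π-return i) ⟨
      μ i * (π i * m i i)     ≡⟨ swap (μ i) (π i) (m i i) ⟩
      π i * (μ i * m i i)     ≡⟨ cong (π i *_) (stationary⇒return μ total invariant i) ⟩
      π i * 1ℚ                ≡⟨ *-identityʳ (π i) ⟩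
      π i                     ∎
      where
      open ≡-Reasoning
      open IsStationary stationary
      swap : ∀ p q r → p * (q * r) ≡ q * (p * r)
      swap = solve-∀ ring

    -- Away from `i` this is the first-step equation times `π u`. At `i` the removed return time
    -- leaves an extra `- π i * m i i`, which is `-1` by Kac's formula.
    L-h : ∀ i u → L (h i) u ≡ π u - δ u i
    L-h i u = begin
      L (h i) u
        ≡⟨ L-π (h i) u ⟩
      π u * h i u - sum (λ v → w u v * h i v)
        ≡⟨ cong (λ p → π u * h i u - p) (sum-cong-≗ λ v → trans (cong (_* h i v) (sym (π*P≡w u v))) (*-assoc (π u) (P u v) (h i v))) ⟩
      π u * h i u - sum (λ v → π u * (P u v * h i v))
        ≡⟨ cong (λ p → π u * h i u - p) (*-distribˡ-sum (π u) (λ v → P u v * h i v)) ⟨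
      π u * (m u i - δ u i * m i i) - π u * T
        ≡⟨ cong (λ p → π u * (p - δ u i * m i i) - π u * T) (m-step u i) ⟩
      π u * (1ℚ + T - δ u i * m i i) - π u * T
        ≡⟨ cancel (π u) T (δ u i) (m i i) ⟩
      π u - δ u i * (π u * m i i)
        ≡⟨ cong (λ p → π u - p) (at-target (u ≟ i)) ⟩
      π u - δ u i ∎
      where
      open ≡-Reasoning
      T = sum (λ v → P u v * h i v)
      cancel : ∀ p t d m → p * (1ℚ + t - d * m) - p * t ≡ p - d * (p * m)
      cancel = solve-∀ ring
      at-target : Dec (u ≡ i) → δ u i * (π u * m i i) ≡ δ u i
      at-target (yes refl) = trans (cong (δ u u *_) (π-return u)) (*-identityʳ (δ u u))
      at-target (no u≢i)   = trans (cong (_* (π u * m i i)) (δ-≢ u≢i)) (trans (*-zeroˡ (π u * m i i)) (sym (δ-≢ u≢i)))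

    open HittingTimes π-total h h-target L-h public

    -- The return term at `j` contributes `π j * m j j`, which is 1 and cancels the `-1` of the
    -- definition.
    kemeny-formula : ∀ {μ} → IsStationary G μ → ∀ j → sum (λ i → μ i * m j i) - 1ℚ ≡ kemeny j
    kemeny-formula {μ} stationary j = begin
      sum (λ i → μ i * m j i) - 1ℚ
        ≡⟨ cong (_- 1ℚ) (sum-cong-≗ λ i → trans (cong (_* m j i) (stationary-unique stationary i)) (split (π i) (m j i) (δ j i) (m i i))) ⟩
      sum (λ i → π i * h i j + δ j i * (π i * m i i)) - 1ℚ
        ≡⟨ cong (_- 1ℚ) (∑-distrib-+ (λ i → π i * h i j) (λ i → δ j i * (π i * m i i))) ⟩
      kemeny j + sum (λ i → δ j i * (π i * m i i)) - 1ℚ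
        ≡⟨ cong (λ p → kemeny j + p - 1ℚ) (trans (sum-cong-≗ λ i → cong₂ _*_ (δ-sym j i) (π-return i)) (sum-δ j (λ _ → 1ℚ))) ⟩
      kemeny j + 1ℚ - 1ℚ
        ≡⟨ cancel (kemeny j) ⟩
      kemeny j ∎
      where
      open ≡-Reasoning
      split : ∀ p m d m′ → p * m ≡ p * (m - d * m′) + d * (p * m′)
      split = solve-∀ ring
      cancel : ∀ p → p + 1ℚ - 1ℚ ≡ p
      cancel = solve-∀ ring

    kemeny-colour-bound : ∀ {k} → Colorable G k → .{{_ : ℕ.NonZero k}} → ∀ j →
                          ℕtoℚ n - (1ℚ + 1ℚ) + (+ 1) / k ≤ kemeny j
    kemeny-colour-bound {k} colouring j = subst (ℕtoℚ n - (1ℚ + 1ℚ) + (+ 1) / k ≤_) (kemeny-average w-connected j)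
      (Coloured.kemeny-bound (proj₁ colouring) (w-proper colouring) 0<π (+ 1 / k)
        (trans (*-comm (ℕtoℚ k) (+ 1 / k)) ([a/d]*d≡a 1 k)))

-- From the bound on Kemeny's constant to the bound on the chromatic number.

1/p≤q : ∀ {p q} → 0ℚ < p → 1ℚ ≤ q * p → Σ[ nz ∈ NonZero p ] q ≥ (1/ p) {{nz}}
1/p≤q {p} {q} 0<p 1≤qp = nz , *-cancelʳ-≤-pos p {{positive 0<p}} (subst (_≤ q * p) (sym (*-inverseˡ p {{nz}})) 1≤qp)
  where nz = pos⇒nonZero p {{positive 0<p}}

corollary4p3 : ∀ (n : ℕ) → 2 ℕ.≤ n → (G : Graph n) → Connected G →
    ∀ (χ : ℕ) → IsChromaticNumber G χ → ∀ (K : ℚ) → IsKemenyConstant G K →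
    Σ[ nz ∈ NonZero (K - ℕtoℚ n + ℕtoℚ 2) ] (ℕtoℚ χ ≥ (1/ (K - ℕtoℚ n + ℕtoℚ 2)) {{nz}})
corollary4p3 n 2≤n G connected χ chromatic K kemenyConstant =
  -- The single estimate `1/χ≤x` is used twice: it makes the denominator positive, hence nonzero,
  -- and after multiplication by `χ` it gives the inequality.
  1/p≤q (<-≤-trans (0<a/d 1 χ) 1/χ≤x) (begin
    1ℚ                                    ≡⟨ [a/d]*d≡a 1 χ ⟨
    (+ 1 / χ) * ℕtoℚ χ                    ≡⟨ *-comm (+ 1 / χ) (ℕtoℚ χ) ⟩
    ℕtoℚ χ * (+ 1 / χ)                    ≤⟨ *-monoˡ-≤-nonNeg (ℕtoℚ χ) {{nonNegative (0≤ℕtoℚ χ)}} 1/χ≤x ⟩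
    ℕtoℚ χ * (K - ℕtoℚ n + ℕtoℚ 2)        ∎)
  where
  open ≤-Reasoning
  open IsKemenyConstant kemenyConstant using (m; mean; j; formula; stationary)
  open IsChromaticNumber chromatic using (colorable)
  module W = SimpleRandomWalk G connected (connected⇒neighbour G 2≤n connected) j
  module M = W.Means m mean
  instance
    χ≢0 : ℕ.NonZero χ
    -- The vertex `j` has a colour, so at least one colour exists.
    χ≢0 = nonZeroIndex (proj₁ colorable j)
  shift : ∀ n q → n - (1ℚ + 1ℚ) + q - n + (1ℚ + 1ℚ) ≡ q
  shift = solve-∀ ring
  1/χ≤x : + 1 / χ ≤ K - ℕtoℚ n + ℕtoℚ 2
  1/χ≤x = begin
    + 1 / χ
      ≡⟨ shift (ℕtoℚ n) (+ 1 / χ) ⟨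
    ℕtoℚ n - (1ℚ + 1ℚ) + (+ 1) / χ - ℕtoℚ n + (1ℚ + 1ℚ)
      ≤⟨ +-monoˡ-≤ (1ℚ + 1ℚ) (+-monoˡ-≤ (- ℕtoℚ n) (M.kemeny-colour-bound colorable j)) ⟩
    M.kemeny j - ℕtoℚ n + (1ℚ + 1ℚ)
      ≡⟨ cong (λ p → p - ℕtoℚ n + (1ℚ + 1ℚ)) (trans formula (M.kemeny-formula stationary j)) ⟨
    K - ℕtoℚ n + (1ℚ + 1ℚ)
      ≡⟨ cong (λ p → K - ℕtoℚ n + p) (ℕtoℚ-+ 1 1) ⟨
    K - ℕtoℚ n + ℕtoℚ 2 ∎
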